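{- There exist self-full ceers $X$ and $Y$ such that the uniform join $X\oplus Y$ is not self-full.
   Context: A ceer is a computably enumerable equivalence relation on $\omega$. For equivalence relations $R,S$ on $\omega$, $R\leq S$ ($R$ is computably reducible to $S$) if there is a total computable $f$ with $x\,R\,y \Leftrightarrow f(x)\,S\,f(y)$ for all $x,y$; such $f$ is called a reduction of $R$ to $S$. A ceer $R$ is self-full if every computable reduction $f$ of $R$ to $R$ has range intersecting every $R$-equivalence class. The uniform join is $R\oplus S=\{(2x,2y):(x,y)\in R\}\cup\{(2x+1,2y+1):(x,y)\in S\}$. -}

module Defs where

open import Data.Nat using (ℕ; zero; suc; _+_; _*_; _<_)
open import Data.Fin using (Fin)
open import Data.Vec using (Vec; []; _∷_; lookup)
open import Data.Product using (Σ; ∃; _×_; _,_)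
open import Relation.Binary.Structures using (IsEquivalence)
open import Function.Bundles using (_⇔_)

data PR : ℕ → Set where
  zer  : ∀ {n} → PR n
  succ : PR 1
  proj : ∀ {n} → Fin n → PR n
  comp : ∀ {m n} → PR m → Vec (PR n) m → PR n
  prec : ∀ {n} → PR n → PR (suc (suc n)) → PR (suc n)
  mu   : ∀ {n} → PR (suc n) → PR n

mutual
  data Eval : ∀ {n} → PR n → Vec ℕ n → ℕ → Set where
    ev-zer  : ∀ {n} {xs : Vec ℕ n} → Eval zer xs 0
    ev-succ : ∀ {x} → Eval succ (x ∷ []) (suc x)
    ev-proj : ∀ {n} {i : Fin n} {xs} → Eval (proj i) xs (lookup xs i)
    ev-comp : ∀ {m n} {f : PR m} {gs : Vec (PR n) m} {xs ys v} →
              EvalAll gs xs ys → Eval f ys v → Eval (comp f gs) xs v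
    ev-prec-z : ∀ {n} {g : PR n} {h : PR (suc (suc n))} {xs v} →
              Eval g xs v → Eval (prec g h) (zero ∷ xs) v
    ev-prec-s : ∀ {n} {g : PR n} {h : PR (suc (suc n))} {k xs r v} →
              Eval (prec g h) (k ∷ xs) r → Eval h (k ∷ r ∷ xs) v →
              Eval (prec g h) (suc k ∷ xs) v
    ev-mu   : ∀ {n} {f : PR (suc n)} {xs y} →
              Eval f (y ∷ xs) 0 →
              (∀ z → z < y → Σ ℕ λ w → Eval f (z ∷ xs) (suc w)) →
              Eval (mu f) xs y

  data EvalAll : ∀ {m n} → Vec (PR n) m → Vec ℕ n → Vec ℕ m → Set where
    ev-[] : ∀ {n} {xs : Vec ℕ n} → EvalAll [] xs []
    ev-∷  : ∀ {m n} {g : PR n} {gs : Vec (PR n) m} {xs y ys} →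
            Eval g xs y → EvalAll gs xs ys → EvalAll (g ∷ gs) xs (y ∷ ys)

Computable : (ℕ → ℕ) → Set
Computable f = Σ (PR 1) λ c → ∀ x → Eval c (x ∷ []) (f x)

CE : (ℕ → ℕ → Set) → Set
CE R = Σ (PR 2) λ c → ∀ x y → (R x y ⇔ (Σ ℕ λ v → Eval c (x ∷ y ∷ []) v))

Ceer : (ℕ → ℕ → Set) → Set
Ceer R = IsEquivalence R × CE R

IsReduction : (R S : ℕ → ℕ → Set) → (ℕ → ℕ) → Set
IsReduction R S f = Computable f × (∀ x y → (R x y ⇔ S (f x) (f y)))

SelfFull : (ℕ → ℕ → Set) → Set
SelfFull R = ∀ f → IsReduction R R f → ∀ x → Σ ℕ λ y → R (f y) x

data Join (R S : ℕ → ℕ → Set) : ℕ → ℕ → Set where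
  left  : ∀ {x y} → R x y → Join R S (2 * x) (2 * y)
  right : ∀ {x y} → S x y → Join R S (suc (2 * x)) (suc (2 * y))

-- Fix a shift on the elements of infinitely many chains, where every element has one of two
-- colours. The real elements of X and of Y are those of its own colour, and all others form one
-- junk class. Sending a real element to its shift, on the side of the colour found there, and
-- fixing junk, is a reduction of X ⊕ Y to itself that misses the origin of chain 0.
--
-- A finite injury argument makes every reduction f of X (or Y) to itself fix all classes. When f u
-- is not equivalent to a real u, a new chain w copies the colours of the chain from u on. Once f w
-- has converged, w is merged with u if this keeps f u and f w apart, which destroys f. Otherwise
-- f w is a proper shift of w (f u being the same shift of u), and w escapes: from then on its
-- elements get the other colour. A second attack of the same kind, on those u with f u outside the
-- forward orbit of u, forces f to move along chains, so the iterates of the injective f on w leave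
-- the finite real part of w, a contradiction.

module Submission where

open import Defs
open import Data.Bool using (Bool; true; false; if_then_else_; _∧_; _∨_; not; T)
open import Data.Bool.Properties using (¬-not; not-¬; not-involutive) renaming (_≟_ to _≟ᵇ_)
open import Data.Empty using (⊥; ⊥-elim)
open import Data.Fin using (Fin; zero; suc)
open import Data.Nat using (ℕ; zero; suc; _+_; _*_; _∸_; _<_; _≤_; pred; _<ᵇ_; _≡ᵇ_; z≤n; s≤s; _⊔_; _≤′_; ≤′-refl; ≤′-step; _^_; _⊓_)
open import Data.Nat.GeneralisedArithmetic using (fold; fold-+)
open import Data.Nat.Induction using (<-wellFounded)
open import Data.Nat.Properties using (+-comm; +-assoc; +-suc; ≤-refl; ≤-trans; ≤-reflexive; <⇒≤; m≤m+n; m≤n+m; +-monoʳ-<; +-mono-≤; ≮⇒≥; <ᵇ⇒<; <⇒<ᵇ; <-cmp; <⇒≱; m+n∸n≡m; m∸n+n≡m; m+n∸m≡n; m+[n∸m]≡n; +-cancelˡ-<; +-identityʳ; ≤⇒≤′; ≤-total; m≤m⊔n; m≤n⊔m; ≰⇒>; ≤-pred; ≡ᵇ⇒≡; <-irrefl; n≤1+n; n<1+n; n∸n≡0; +-monoˡ-<; ≤-<-trans; m≤n⇒m<n∨m≡n; <-trans; +-∸-assoc; ≤-<-connex; _≟_; _≤?_; <⇒≢; 1+n≢0; m<1+n⇒m≤n; n≤0⇒n≡0; m⊓n≤n; *-monoʳ-≤; *-suc; m<m+n; +-cancelˡ-≡; +-cancelʳ-≡)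
open import Data.Product using (Σ; ∃; _×_; _,_; proj₁; proj₂; ∃₂)
open import Data.Sum using (inj₁; inj₂; _⊎_)
open import Data.Unit using (tt)
open import Data.Vec using (Vec; []; _∷_; lookup; head; tail; tabulate)
open import Data.Vec.Properties using (tabulate∘lookup)
open import Function using (_∘_)
open import Function.Bundles using (mk⇔; Equivalence)
open import Induction.WellFounded using (Acc; acc)
open import Relation.Binary.Definitions using (tri<; tri≈; tri>)
open import Relation.Binary.PropositionalEquality using (_≡_; refl; sym; trans; cong; subst; cong₂; _≢_; subst₂)
open import Relation.Nullary using (¬_; yes; no)

-- Primitive recursive combinators

-- The shift must respect the classes, so identifying `u` with `w` identifies `u ⊕ k` with `w ⊕ k`
-- for all `k`, also where these are real on the other side. Hence a new chain has to copy colours.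
-- This is also the obstacle: if `f` acts like a shift, `f u` and `f w` merge along with `u` and
-- `w`, and no contradiction arises. The escape answers it by making almost all of chain `w` junk,
-- which leaves a shift-like `f` no room there.
--
-- The map on the join reads colours, so the colour of `x` must be computable. It is fixed for good
-- by the log up to stage `ch x + ps x`, and an escape recolours only elements not yet fixed. What
-- is real on one side is junk on the other, so a single log with a single shift serves both
-- relations.
--
-- Self-fullness comes in the strong form that every reduction maps each element into its own class.
-- Of the two kinds of attack, the one with the weaker conclusion is evaluated first: knowing that
-- `f u` is in the forward orbit of `u` for all real `u` is what lets the iterates of `f` be
-- followed along an escaped chain.

record Prim {n} (F : Vec ℕ n → ℕ) : Set where
  constructor prim
  field
    code : PR n
    eval : ∀ ρ → Eval code ρ (F ρ)
open Prim public

variable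
  n k : ℕ
  F G H M N O : Vec ℕ n → ℕ
  A B : Vec ℕ n → Bool

Prim-cong : (∀ ρ → F ρ ≡ G ρ) → Prim F → Prim G
Prim-cong eq (prim c ev) = prim c λ ρ → subst (Eval c ρ) (eq ρ) (ev ρ)

varᵖ : ∀ (i : Fin n) → Prim (λ ρ → lookup ρ i)
varᵖ i = prim (proj i) λ _ → ev-proj

zeroᵖ : Prim {n} (λ _ → 0)
zeroᵖ = prim zer λ _ → ev-zer

sucᵖ : Prim F → Prim (suc ∘ F)
sucᵖ (prim a eva) = prim (comp succ (a ∷ [])) λ ρ → ev-comp (ev-∷ (eva ρ) ev-[]) ev-succ

constᵖ : ∀ k → Prim {n} (λ _ → k)
constᵖ zero    = zeroᵖ
constᵖ (suc k) = sucᵖ (constᵖ k)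

private
  evalTabulate : ∀ {m n} {ρ : Vec ℕ n} (g : Fin m → PR n) (v : Fin m → ℕ) →
                 (∀ i → Eval (g i) ρ (v i)) → EvalAll (tabulate g) ρ (tabulate v)
  evalTabulate {zero}  g v ev = ev-[]
  evalTabulate {suc m} g v ev = ev-∷ (ev zero) (evalTabulate (g ∘ suc) (v ∘ suc) (ev ∘ suc))

  evalSelect : ∀ {m n} {ρ : Vec ℕ n} {σ : Vec ℕ m} (g : Fin m → PR n) →
               (∀ i → Eval (g i) ρ (lookup σ i)) → EvalAll (tabulate g) ρ σ
  evalSelect {ρ = ρ} {σ} g ev =
    subst (EvalAll (tabulate g) ρ) (tabulate∘lookup σ) (evalTabulate g (lookup σ) ev)

weaken : Prim F → Prim {suc n} (F ∘ tail)
weaken (prim c ev) = prim (comp c (tabulate (proj ∘ suc))) λ where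
  (x ∷ ρ) → ev-comp (evalSelect (proj ∘ suc) (λ _ → ev-proj)) (ev ρ)

primrec : ℕ → (ℕ → ℕ → ℕ) → ℕ → ℕ
primrec z f zero    = z
primrec z f (suc n) = f n (primrec z f n)

primrecᵖ : {f : Vec ℕ n → ℕ → ℕ → ℕ} →
           Prim F → Prim (λ ρ → f (tail (tail ρ)) (head ρ) (head (tail ρ))) → Prim G →
           Prim (λ ρ → primrec (F ρ) (f ρ) (G ρ))
primrecᵖ {n} {F} {G} {f} (prim z evz) (prim s evs) (prim k evk) =
  prim (comp (prec z s) (k ∷ tabulate proj)) λ ρ →
    ev-comp (ev-∷ (evk ρ) (evalSelect proj (λ _ → ev-proj))) (loop ρ (G ρ))
  where
  loop : ∀ ρ m → Eval (prec z s) (m ∷ ρ) (primrec (F ρ) (f ρ) m)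
  loop ρ zero    = ev-prec-z (evz ρ)
  loop ρ (suc m) = ev-prec-s (loop ρ m) (evs _)

fold≡primrec : ∀ z (f : ℕ → ℕ) n → primrec z (λ _ → f) n ≡ fold z f n
fold≡primrec z f zero    = refl
fold≡primrec z f (suc n) = cong f (fold≡primrec z f n)

fold-suc : ∀ (f : ℕ → ℕ) z n → fold z f (suc n) ≡ fold (f z) f n
fold-suc f z zero    = refl
fold-suc f z (suc n) = cong f (fold-suc f z n)

headᵖ : Prim {suc n} head
headᵖ = Prim-cong (λ { (x ∷ ρ) → refl }) (varᵖ zero)

foldᵖ : {f : Vec ℕ n → ℕ → ℕ} → Prim F → Prim (λ ρ → f (tail ρ) (head ρ)) → Prim G →
        Prim (λ ρ → fold (F ρ) (f ρ) (G ρ))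
foldᵖ {F = F} {G} {f} z s k = Prim-cong (λ ρ → fold≡primrec (F ρ) (f ρ) (G ρ))
  (primrecᵖ z (Prim-cong (λ { (_ ∷ _ ∷ _) → refl }) (weaken s)) k)

predᵖ : Prim F → Prim (pred ∘ F)
predᵖ {F = F} k = Prim-cong (lemma ∘ F) (primrecᵖ {f = λ _ m _ → m} zeroᵖ headᵖ k)
  where
  lemma : ∀ m → primrec 0 (λ m _ → m) m ≡ pred m
  lemma zero    = refl
  lemma (suc m) = refl

infixl 6 _+ᵖ_ _∸ᵖ_
infix 4 _≡ᵖ_ _<ᵖ_
infixr 6 _∧ᵖ_
infixr 5 _∨ᵖ_

_+ᵖ_ : Prim F → Prim G → Prim (λ ρ → F ρ + G ρ)
_+ᵖ_ {F = F} {G} a b = Prim-cong (λ ρ → lemma (F ρ) (G ρ)) (foldᵖ {f = λ _ → suc} b (sucᵖ headᵖ) a)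
  where
  lemma : ∀ m k → fold k suc m ≡ m + k
  lemma zero    k = refl
  lemma (suc m) k = cong suc (lemma m k)

_∸ᵖ_ : Prim F → Prim G → Prim (λ ρ → F ρ ∸ G ρ)
_∸ᵖ_ {F = F} {G} a b = Prim-cong (λ ρ → lemma (F ρ) (G ρ)) (foldᵖ {f = λ _ → pred} a (predᵖ headᵖ) b)
  where
  pred-∸ : ∀ m k → pred (m ∸ k) ≡ m ∸ suc k
  pred-∸ zero    zero    = refl
  pred-∸ zero    (suc k) = refl
  pred-∸ (suc m) zero    = refl
  pred-∸ (suc m) (suc k) = pred-∸ m k
  lemma : ∀ m k → fold m pred k ≡ m ∸ k
  lemma m zero    = refl
  lemma m (suc k) = trans (cong pred (lemma m k)) (pred-∸ m k)

bit : Bool → ℕ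
bit true  = 1
bit false = 0

record PrimBool {n} (A : Vec ℕ n → Bool) : Set where
  constructor bool
  field asBit : Prim (bit ∘ A)
open PrimBool public

PrimBool-cong : (∀ ρ → A ρ ≡ B ρ) → PrimBool A → PrimBool B
PrimBool-cong eq (bool a) = bool (Prim-cong (cong bit ∘ eq) a)

ifᵖ : PrimBool A → Prim F → Prim G → Prim (λ ρ → if A ρ then F ρ else G ρ)
ifᵖ {A = A} {F} {G} (bool a) f g = Prim-cong (λ ρ → lemma (A ρ))
  (primrecᵖ {f = λ ρ _ _ → F ρ} g (weaken (weaken f)) a)
  where
  lemma : ∀ {x y} b → primrec y (λ _ _ → x) (bit b) ≡ (if b then x else y)
  lemma true  = refl
  lemma false = refl

constᵇ : ∀ b → PrimBool {n} (λ _ → b)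
constᵇ b = bool (constᵖ (bit b))

ifᵇ : {C : Vec ℕ n → Bool} → PrimBool A → PrimBool B → PrimBool C →
      PrimBool (λ ρ → if A ρ then B ρ else C ρ)
ifᵇ {A = A} a (bool b) (bool c) = bool (Prim-cong (λ ρ → lemma (A ρ)) (ifᵖ a b c))
  where
  lemma : ∀ {x y} b → (if b then bit x else bit y) ≡ bit (if b then x else y)
  lemma true  = refl
  lemma false = refl

notᵖ : PrimBool A → PrimBool (not ∘ A)
notᵖ {A = A} a = PrimBool-cong (λ ρ → lemma (A ρ)) (ifᵇ a (constᵇ false) (constᵇ true))
  where
  lemma : ∀ b → (if b then false else true) ≡ not b
  lemma true  = refl
  lemma false = refl

_∧ᵖ_ : PrimBool A → PrimBool B → PrimBool (λ ρ → A ρ ∧ B ρ)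
_∧ᵖ_ {A = A} a b = PrimBool-cong (λ ρ → lemma (A ρ)) (ifᵇ a b (constᵇ false))
  where
  lemma : ∀ {y} b → (if b then y else false) ≡ b ∧ y
  lemma true  = refl
  lemma false = refl

_∨ᵖ_ : PrimBool A → PrimBool B → PrimBool (λ ρ → A ρ ∨ B ρ)
_∨ᵖ_ {A = A} a b = PrimBool-cong (λ ρ → lemma (A ρ)) (ifᵇ a (constᵇ true) b)
  where
  lemma : ∀ {y} b → (if b then true else y) ≡ b ∨ y
  lemma true  = refl
  lemma false = refl

_<ᵖ_ : Prim F → Prim G → PrimBool (λ ρ → F ρ <ᵇ G ρ)
_<ᵖ_ {F = F} {G} a b = bool (Prim-cong (λ ρ → lemma (F ρ) (G ρ))
  (primrecᵖ {f = λ _ _ _ → 1} zeroᵖ (constᵖ 1) (b ∸ᵖ a)))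
  where
  lemma : ∀ m k → primrec 0 (λ _ _ → 1) (k ∸ m) ≡ bit (m <ᵇ k)
  lemma zero    zero    = refl
  lemma zero    (suc k) = refl
  lemma (suc m) zero    = refl
  lemma (suc m) (suc k) = lemma m k

_≡ᵖ_ : Prim F → Prim G → PrimBool (λ ρ → F ρ ≡ᵇ G ρ)
_≡ᵖ_ {F = F} {G} a b = PrimBool-cong (λ ρ → lemma (F ρ) (G ρ)) (notᵖ ((a <ᵖ b) ∨ᵖ (b <ᵖ a)))
  where
  lemma : ∀ m k → not ((m <ᵇ k) ∨ (k <ᵇ m)) ≡ (m ≡ᵇ k)
  lemma zero    zero    = refl
  lemma zero    (suc k) = refl
  lemma (suc m) zero    = refl
  lemma (suc m) (suc k) = lemma m k

-- The step function of `primrecᵖ` sees the counter, then the accumulator, then the parameters; the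
-- body of a search does not depend on the accumulator.
skip : Prim {suc n} F → Prim {suc (suc n)} (λ ρ → F (head ρ ∷ tail (tail ρ)))
skip (prim c ev) = prim (comp c (proj zero ∷ tabulate (λ i → proj (suc (suc i))))) λ where
  (x ∷ y ∷ ρ) → ev-comp (ev-∷ ev-proj (evalSelect _ (λ _ → ev-proj))) (ev _)

-- The value 0 stands for failure, so a hit must have a non-zero value. That the least hit wins is
-- the priority rule when `act` searches through the requirements.
first : (ℕ → ℕ) → ℕ → ℕ
first g = primrec 0 (λ i r → if r ≡ᵇ 0 then g i else r)

firstᵖ : {g : Vec ℕ n → ℕ → ℕ} → Prim (λ ρ → g (tail ρ) (head ρ)) → Prim F → Prim (λ ρ → first (g ρ) (F ρ))
firstᵖ {g = g} a k = primrecᵖ {f = λ ρ i r → if r ≡ᵇ 0 then g ρ i else r} zeroᵖ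
  (ifᵖ (weaken headᵖ ≡ᵖ zeroᵖ) (skip a) (weaken headᵖ)) k

some : (ℕ → Bool) → ℕ → Bool
some p k = 0 <ᵇ first (bit ∘ p) k

someᵖ : {p : Vec ℕ n → ℕ → Bool} → PrimBool (λ ρ → p (tail ρ) (head ρ)) → Prim F → PrimBool (λ ρ → some (p ρ) (F ρ))
someᵖ {p = p} (bool a) k = zeroᵖ <ᵖ firstᵖ {g = λ ρ → bit ∘ p ρ} a k

-- Cantor pairing

opaque
  triangle : ℕ → ℕ
  triangle zero    = 0
  triangle (suc k) = triangle k + suc k

  -- The largest `d` with `triangle d ≤ n`. It grows by at most one at each successor, which gives a
  -- primitive recursion without a search.
  diagonal : ℕ → ℕ
  diagonal zero    = 0
  diagonal (suc n) = if suc n <ᵇ triangle (suc (diagonal n)) then diagonal n else suc (diagonal n)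

  infix 5 ⟨_,_⟩
  ⟨_,_⟩ : ℕ → ℕ → ℕ
  ⟨ a , b ⟩ = triangle (a + b) + b

  snd : ℕ → ℕ
  snd n = n ∸ triangle (diagonal n)

  fst : ℕ → ℕ
  fst n = diagonal n ∸ snd n

  private
    triangle-mono : ∀ {a b} → a ≤ b → triangle a ≤ triangle b
    triangle-mono z≤n     = z≤n
    triangle-mono (s≤s p) = +-mono-≤ (triangle-mono p) (s≤s p)

    n≤triangle : ∀ n → n ≤ triangle n
    n≤triangle zero    = z≤n
    n≤triangle (suc n) = m≤n+m (suc n) (triangle n)

    diagonal-bounds : ∀ n → triangle (diagonal n) ≤ n × n < triangle (suc (diagonal n))
    diagonal-bounds zero = z≤n , s≤s z≤n
    diagonal-bounds (suc n) with suc n <ᵇ triangle (suc (diagonal n)) in eq | diagonal-bounds n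
    ... | true  | lo , hi = ≤-trans lo (m≤n+m n 1) , <ᵇ⇒< _ _ (subst T (sym eq) tt)
    ... | false | lo , hi = ≮⇒≥ (λ lt → subst T eq (<⇒<ᵇ lt)) ,
          ≤-trans (s≤s hi) (≤-trans (s≤s (m≤m+n _ (suc (diagonal n)))) (≤-reflexive (sym (+-suc _ (suc (diagonal n))))))

    diagonal-unique : ∀ d n → triangle d ≤ n → n < triangle (suc d) → diagonal n ≡ d
    diagonal-unique d n lo hi with <-cmp (diagonal n) d | diagonal-bounds n
    ... | tri≈ _ eq _ | _ = eq
    ... | tri< lt _ _ | _ , hi' = ⊥-elim (<⇒≱ hi' (≤-trans (triangle-mono lt) lo))
    ... | tri> _ _ gt | lo' , _ = ⊥-elim (<⇒≱ hi (≤-trans (triangle-mono gt) lo'))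

    diagonal-pair : ∀ a b → diagonal ⟨ a , b ⟩ ≡ a + b
    diagonal-pair a b = diagonal-unique (a + b) ⟨ a , b ⟩ (m≤m+n _ b)
      (+-monoʳ-< (triangle (a + b)) (s≤s (m≤n+m b a)))

    snd≤diagonal : ∀ n → snd n ≤ diagonal n
    snd≤diagonal n with diagonal-bounds n
    ... | lo , hi with +-cancelˡ-< (triangle (diagonal n)) _ _ (subst (_< triangle (suc (diagonal n))) (sym (m+[n∸m]≡n lo)) hi)
    ... | s≤s le = le

  snd-pair : ∀ a b → snd ⟨ a , b ⟩ ≡ b
  snd-pair a b rewrite diagonal-pair a b = m+n∸m≡n (triangle (a + b)) b

  fst-pair : ∀ a b → fst ⟨ a , b ⟩ ≡ a
  fst-pair a b rewrite snd-pair a b | diagonal-pair a b = m+n∸n≡m a b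

  pair-surjective : ∀ n → ⟨ fst n , snd n ⟩ ≡ n
  pair-surjective n rewrite m∸n+n≡m (snd≤diagonal n) = m+[n∸m]≡n (proj₁ (diagonal-bounds n))

  fst+snd≤ : ∀ n → fst n + snd n ≤ n
  fst+snd≤ n rewrite m∸n+n≡m (snd≤diagonal n) = ≤-trans (n≤triangle _) (proj₁ (diagonal-bounds n))

  fst-zero : fst 0 ≡ 0
  fst-zero = refl

  private
    triangleᵖ : Prim M → Prim (λ ρ → triangle (M ρ))
    triangleᵖ {M = M} a = Prim-cong (lemma ∘ M)
      (primrecᵖ {f = λ _ m r → r + suc m} zeroᵖ (Prim-cong (λ { (_ ∷ _) → refl }) (weaken headᵖ) +ᵖ sucᵖ headᵖ) a)
      where
      lemma : ∀ m → primrec 0 (λ m r → r + suc m) m ≡ triangle m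
      lemma zero    = refl
      lemma (suc m) = cong (_+ suc m) (lemma m)

    diagonalᵖ : Prim M → Prim (λ ρ → diagonal (M ρ))
    diagonalᵖ {M = M} a = Prim-cong (lemma ∘ M)
      (primrecᵖ {f = λ _ m r → if suc m <ᵇ triangle (suc r) then r else suc r} zeroᵖ
        (ifᵖ (sucᵖ headᵖ <ᵖ triangleᵖ (sucᵖ (weaken headᵖ))) (weaken headᵖ) (sucᵖ (weaken headᵖ))) a)
      where
      lemma : ∀ m → primrec 0 (λ m r → if suc m <ᵇ triangle (suc r) then r else suc r) m ≡ diagonal m
      lemma zero    = refl
      lemma (suc m) = cong (λ r → if suc m <ᵇ triangle (suc r) then r else suc r) (lemma m)

  ⟨_,_⟩ᵖ : Prim M → Prim N → Prim (λ ρ → ⟨ M ρ , N ρ ⟩)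
  ⟨ a , b ⟩ᵖ = triangleᵖ (a +ᵖ b) +ᵖ b

  sndᵖ : Prim M → Prim (λ ρ → snd (M ρ))
  sndᵖ a = a ∸ᵖ triangleᵖ (diagonalᵖ a)

  fstᵖ : Prim M → Prim (λ ρ → fst (M ρ))
  fstᵖ a = diagonalᵖ a ∸ᵖ sndᵖ a

-- A universal machine

-- A state ⟨ K , v ⟩ has a stack K of instructions (0 or suc ⟨ instruction , K' ⟩) and a value v.
opaque
  instr : ℕ → ℕ → ℕ → ℕ
  instr τ a b = ⟨ τ , ⟨ a , b ⟩ ⟩

  infixr 6 _▹_
  _▹_ : ℕ → ℕ → ℕ
  i ▹ K = suc ⟨ i , K ⟩

  state : ℕ → ℕ → ℕ
  state K v = ⟨ K , v ⟩

  -- Opcodes 0 to 4 act on the value, 5 composes two programs, 6 starts a pairing, and the default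
  -- is a while loop that pushes itself again. Opcodes 7 and 8 are the continuations of a pairing: 7
  -- holds the second program and the saved input, 8 holds the first result.
  execute : (τ a b K v : ℕ) → ℕ
  execute τ a b K v =
    if τ ≡ᵇ 0 then ⟨ K , 0 ⟩ else
    if τ ≡ᵇ 1 then ⟨ K , suc v ⟩ else
    if τ ≡ᵇ 2 then ⟨ K , fst v ⟩ else
    if τ ≡ᵇ 3 then ⟨ K , snd v ⟩ else
    if τ ≡ᵇ 4 then ⟨ K , pred v ⟩ else
    if τ ≡ᵇ 5 then ⟨ a ▹ b ▹ K , v ⟩ else
    if τ ≡ᵇ 6 then ⟨ a ▹ instr 7 b v ▹ K , v ⟩ else
    if τ ≡ᵇ 7 then ⟨ a ▹ instr 8 v 0 ▹ K , b ⟩ else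
    if τ ≡ᵇ 8 then ⟨ K , ⟨ a , v ⟩ ⟩ else
    (if fst v ≡ᵇ 0 then ⟨ K , snd v ⟩ else ⟨ a ▹ instr 9 a 0 ▹ K , v ⟩)

  -- A state with an empty stack is a fixed point, so a result persists once it is reached. As
  -- `step` is primitive recursive, so is the test for halting within a given number of steps.
  step : ℕ → ℕ
  step σ = if fst σ ≡ᵇ 0 then σ else
    (let i = fst (pred (fst σ)) in
     execute (fst i) (fst (snd i)) (snd (snd i)) (snd (pred (fst σ))) (snd σ))

  step-instr : ∀ τ a b K v → step (state (instr τ a b ▹ K) v) ≡ execute τ a b K v
  step-instr τ a b K v
    rewrite fst-pair (instr τ a b ▹ K) v | snd-pair (instr τ a b ▹ K) v
          | fst-pair (instr τ a b) K | snd-pair (instr τ a b) K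
          | fst-pair τ ⟨ a , b ⟩ | snd-pair τ ⟨ a , b ⟩ | fst-pair a b | snd-pair a b = refl

  -- The result plus one, or 0 when the computation has not halted within s steps.
  output : ℕ → ℕ → ℕ → ℕ
  output c x s = let σ = fold (state (c ▹ 0) ⟨ x , 0 ⟩) step s in
    if fst σ ≡ᵇ 0 then suc (snd σ) else 0

  private
    ▹ᵖ : Prim M → Prim N → Prim (λ ρ → M ρ ▹ N ρ)
    ▹ᵖ a b = sucᵖ ⟨ a , b ⟩ᵖ

    instrᵖ : ∀ τ → Prim M → Prim N → Prim (λ ρ → instr τ (M ρ) (N ρ))
    instrᵖ τ a b = ⟨ constᵖ τ , ⟨ a , b ⟩ᵖ ⟩ᵖ

    executeᵖ : ∀ {T A B : Vec ℕ k → ℕ} → Prim T → Prim A → Prim B → Prim N → Prim M →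
               Prim (λ ρ → execute (T ρ) (A ρ) (B ρ) (N ρ) (M ρ))
    executeᵖ τ a b K v =
      ifᵖ (τ ≡ᵖ constᵖ 0) ⟨ K , zeroᵖ ⟩ᵖ
      (ifᵖ (τ ≡ᵖ constᵖ 1) ⟨ K , sucᵖ v ⟩ᵖ
      (ifᵖ (τ ≡ᵖ constᵖ 2) ⟨ K , fstᵖ v ⟩ᵖ
      (ifᵖ (τ ≡ᵖ constᵖ 3) ⟨ K , sndᵖ v ⟩ᵖ
      (ifᵖ (τ ≡ᵖ constᵖ 4) ⟨ K , predᵖ v ⟩ᵖ
      (ifᵖ (τ ≡ᵖ constᵖ 5) ⟨ ▹ᵖ a (▹ᵖ b K) , v ⟩ᵖ
      (ifᵖ (τ ≡ᵖ constᵖ 6) ⟨ ▹ᵖ a (▹ᵖ (instrᵖ 7 b v) K) , v ⟩ᵖ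
      (ifᵖ (τ ≡ᵖ constᵖ 7) ⟨ ▹ᵖ a (▹ᵖ (instrᵖ 8 v zeroᵖ) K) , b ⟩ᵖ
      (ifᵖ (τ ≡ᵖ constᵖ 8) ⟨ K , ⟨ a , v ⟩ᵖ ⟩ᵖ
      (ifᵖ (fstᵖ v ≡ᵖ constᵖ 0) ⟨ K , sndᵖ v ⟩ᵖ ⟨ ▹ᵖ a (▹ᵖ (instrᵖ 9 a zeroᵖ) K) , v ⟩ᵖ)))))))))

    stepᵖ : Prim M → Prim (λ ρ → step (M ρ))
    stepᵖ σ = ifᵖ (fstᵖ σ ≡ᵖ constᵖ 0) σ
      (let i = fstᵖ (predᵖ (fstᵖ σ)) in
       executeᵖ (fstᵖ i) (fstᵖ (sndᵖ i)) (sndᵖ (sndᵖ i)) (sndᵖ (predᵖ (fstᵖ σ))) (sndᵖ σ))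

  outputᵖ : Prim M → Prim N → Prim O → Prim (λ ρ → output (M ρ) (N ρ) (O ρ))
  outputᵖ c x s =
    let σ = foldᵖ ⟨ ▹ᵖ c zeroᵖ , ⟨ x , zeroᵖ ⟩ᵖ ⟩ᵖ (stepᵖ headᵖ) s in
    ifᵖ (fstᵖ σ ≡ᵖ constᵖ 0) (sucᵖ (sndᵖ σ)) zeroᵖ

  output-mono : ∀ c x s v → output c x s ≡ suc v → output c x (suc s) ≡ suc v
  output-mono c x s v eq with fold (state (c ▹ 0) ⟨ x , 0 ⟩) step s
  ... | σ with fst σ ≡ᵇ 0 in h
  ... | true rewrite h = eq
  ... | false with () ← eq

infix 4 _⟶*_
record _⟶*_ (σ τ : ℕ) : Set where
  constructor run
  field
    time : ℕ
    runs : fold σ step time ≡ τ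

variable
  σ τ υ : ℕ

⟶-trans : σ ⟶* τ → τ ⟶* υ → σ ⟶* υ
⟶-trans {σ} (run m refl) (run n refl) = run (n + m) (fold-+ σ step n)

⟶-step : step σ ≡ τ → σ ⟶* τ
⟶-step = run 1

infix 4 _∶_↦_
-- The quantifier over the rest `K` of the stack lets the rules for single instructions compose
-- without any bookkeeping.
_∶_↦_ : ℕ → ℕ → ℕ → Set
i ∶ x ↦ y = ∀ K → state (i ▹ K) x ⟶* state K y

opaque
  unfolding output
  output-complete : ∀ {c x v} → c ∶ ⟨ x , 0 ⟩ ↦ v → ∃ λ s → output c x s ≡ suc v
  output-complete {c} {x} {v} r with r 0
  ... | run s eq = s , lemma
    where
    lemma : output c x s ≡ suc v
    lemma rewrite eq | fst-pair 0 v | snd-pair 0 v = refl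

  seq fork : ℕ → ℕ → ℕ
  seq f g  = instr 5 f g
  fork f g = instr 6 f g

  while : ℕ → ℕ
  while f = instr 9 f 0

  `0 `suc `fst `snd `pred : ℕ
  `0    = instr 0 0 0
  `suc  = instr 1 0 0
  `fst  = instr 2 0 0
  `snd  = instr 3 0 0
  `pred = instr 4 0 0

  do-0 : ∀ {x} → `0 ∶ x ↦ 0
  do-0 K = ⟶-step (step-instr 0 0 0 K _)

  do-suc : ∀ {x} → `suc ∶ x ↦ suc x
  do-suc K = ⟶-step (step-instr 1 0 0 K _)

  do-fst : ∀ {x y} → `fst ∶ ⟨ x , y ⟩ ↦ x
  do-fst {x} {y} K = ⟶-step (trans (step-instr 2 0 0 K _) (cong (state K) (fst-pair x y)))

  do-snd : ∀ {x y} → `snd ∶ ⟨ x , y ⟩ ↦ y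
  do-snd {x} {y} K = ⟶-step (trans (step-instr 3 0 0 K _) (cong (state K) (snd-pair x y)))

  do-pred : ∀ {x} → `pred ∶ x ↦ pred x
  do-pred K = ⟶-step (step-instr 4 0 0 K _)

  do-seq : ∀ {f g x y z} → f ∶ x ↦ y → g ∶ y ↦ z → seq f g ∶ x ↦ z
  do-seq rf rg K = ⟶-trans (⟶-step (step-instr 5 _ _ K _)) (⟶-trans (rf _) (rg K))

  `id : ℕ
  `id = seq `suc `pred

  do-id : ∀ {x} → `id ∶ x ↦ x
  do-id = do-seq do-suc do-pred

  do-fork : ∀ {f g x y z} → f ∶ x ↦ y → g ∶ x ↦ z → fork f g ∶ x ↦ ⟨ y , z ⟩
  do-fork rf rg K = ⟶-trans (⟶-step (step-instr 6 _ _ K _)) (⟶-trans (rf _)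
    (⟶-trans (⟶-step (step-instr 7 _ _ K _)) (⟶-trans (rg _) (⟶-step (step-instr 8 _ _ K _)))))

  while-stop : ∀ {f x} → while f ∶ ⟨ 0 , x ⟩ ↦ x
  while-stop {f} {x} K = ⟶-step (trans (step-instr 9 f 0 K _) lemma)
    where
    lemma : execute 9 f 0 K ⟨ 0 , x ⟩ ≡ state K x
    lemma rewrite fst-pair 0 x | snd-pair 0 x = refl

  while-go : ∀ {f n x y z} → f ∶ ⟨ suc n , x ⟩ ↦ y → while f ∶ y ↦ z → while f ∶ ⟨ suc n , x ⟩ ↦ z
  while-go {f} {n} {x} r w K = ⟶-trans (⟶-step (trans (step-instr 9 f 0 K _) lemma)) (⟶-trans (r _) (w K))
    where
    lemma : execute 9 f 0 K ⟨ suc n , x ⟩ ≡ state (f ▹ while f ▹ K) ⟨ suc n , x ⟩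
    lemma rewrite fst-pair (suc n) x = refl

-- Compilation of recursive codes to machine programs

encode : ∀ {n} → Vec ℕ n → ℕ
encode []       = 0
encode (x ∷ xs) = ⟨ x , encode xs ⟩

`lookup : ∀ {n} → Fin n → ℕ
`lookup zero    = `fst
`lookup (suc i) = seq `snd (`lookup i)

do-lookup : ∀ {n} (i : Fin n) xs → `lookup i ∶ encode xs ↦ lookup xs i
do-lookup zero    (x ∷ xs) = do-fst
do-lookup (suc i) (x ∷ xs) = do-seq do-snd (do-lookup i xs)

-- Loop states: ⟨ remaining rounds , ⟨ counter , ⟨ accumulator , parameters ⟩ ⟩ ⟩.
`prec-body : ℕ → ℕ
`prec-body h = fork (seq `fst `pred) (fork (seq `snd (seq `fst `suc)) (fork (seq `snd h) (seq `snd (seq `snd `snd))))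

-- Loop states: ⟨ last value of f , ⟨ argument , parameters ⟩ ⟩.
`mu-body : ℕ → ℕ
`mu-body f = seq `snd (seq (fork (seq `fst `suc) `snd) (fork f `id))

`prec-loop : ℕ → ℕ → ℕ
`prec-loop g h = seq (fork `fst (fork `0 (fork (seq `snd g) `snd))) (while (`prec-body h))

mutual
  compile : ∀ {n} → PR n → ℕ
  compile zer         = `0
  compile succ        = seq `fst `suc
  compile (proj i)    = `lookup i
  compile (comp f gs) = seq (compileAll gs) (compile f)
  compile (prec g h)  =
    seq (`prec-loop (compile g) (compile h)) (seq `snd `fst)
  compile (mu f)      =
    seq (seq (fork `0 `id) (fork (compile f) `id))
        (seq (while (`mu-body (compile f))) `fst)

  compileAll : ∀ {m n} → Vec (PR n) m → ℕ
  compileAll []       = `0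
  compileAll (g ∷ gs) = fork (compile g) (compileAll gs)

mutual
  compile-correct : ∀ {n} {c : PR n} {xs v} → Eval c xs v → compile c ∶ encode xs ↦ v
  compile-correct ev-zer  = do-0
  compile-correct ev-succ = do-seq do-fst do-suc
  compile-correct (ev-proj {i = i} {xs}) = do-lookup i xs
  compile-correct (ev-comp evs ev) = do-seq (compileAll-correct evs) (compile-correct ev)
  compile-correct ev@(ev-prec-z {xs = xs} _) = do-seq (prec-correct ev 0 _ while-stop) (do-seq do-snd do-fst)
  compile-correct ev@(ev-prec-s {g = g} {h = h} {k = k} {xs} {v = v} _ _) = do-seq
    (subst (λ k′ → `prec-loop (compile g) (compile h) ∶ ⟨ k′ , encode xs ⟩ ↦ ⟨ suc k , ⟨ v , encode xs ⟩ ⟩) (+-identityʳ (suc k)) (prec-correct ev 0 _ while-stop))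
    (do-seq do-snd do-fst)
  compile-correct (ev-mu {f = f} {xs} {y} ev pos) =
    do-seq (do-seq (do-fork do-0 do-id) (do-fork (proj₁ (proj₂ start)) do-id)) (do-seq (proj₂ (proj₂ start)) do-fst)
    where
    -- Recursion on the distance `d` from `z` to the minimum. The value `a` of `f` at `z` is part of
    -- the loop state, because it is tested before the body runs.
    loop : ∀ d z → d + z ≡ y → ∃ λ a → (compile f ∶ ⟨ z , encode xs ⟩ ↦ a) ×
           (while (`mu-body (compile f)) ∶ ⟨ a , ⟨ z , encode xs ⟩ ⟩ ↦ ⟨ y , encode xs ⟩)
    loop zero    z refl = 0 , compile-correct ev , while-stop
    loop (suc d) z eq with pos z (subst (z <_) eq (s≤s (m≤n+m z d))) | loop d (suc z) (trans (+-suc d z) eq)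
    ... | w , evw | a , ra , rest = suc w , compile-correct evw ,
      while-go (do-seq do-snd (do-seq (do-fork (do-seq do-fst do-suc) do-snd) (do-fork ra do-id))) rest
    start = loop y 0 (+-identityʳ y)

  -- The derivation is taken apart from its last round, whereas the machine starts with the first.
  -- Hence the generalisation: after the first `k` rounds `m` more are due, and a run of these is
  -- given.
  prec-correct : ∀ {n k r} {g : PR n} {h} {xs} → Eval (prec g h) (k ∷ xs) r → ∀ m z →
    while (`prec-body (compile h)) ∶ ⟨ m , ⟨ k , ⟨ r , encode xs ⟩ ⟩ ⟩ ↦ z →
    `prec-loop (compile g) (compile h) ∶ ⟨ k + m , encode xs ⟩ ↦ z
  prec-correct (ev-prec-z ev) m z rest =
    do-seq (do-fork do-fst (do-fork do-0 (do-fork (do-seq do-snd (compile-correct ev)) do-snd))) rest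
  prec-correct {g = g} {h} {xs} (ev-prec-s {k = k} evr ev) m z rest =
    subst (λ k′ → `prec-loop (compile g) (compile h) ∶ ⟨ k′ , encode xs ⟩ ↦ z) (+-suc k m)
      (prec-correct evr (suc m) z (while-go
        (do-fork (do-seq do-fst do-pred) (do-fork (do-seq do-snd (do-seq do-fst do-suc))
          (do-fork (do-seq do-snd (compile-correct ev)) (do-seq do-snd (do-seq do-snd do-snd)))))
        rest))

  compileAll-correct : ∀ {m n} {gs : Vec (PR n) m} {xs ys} → EvalAll gs xs ys → compileAll gs ∶ encode xs ↦ encode ys
  compileAll-correct ev-[]        = do-0
  compileAll-correct (ev-∷ ev evs) = do-fork (compile-correct ev) (compileAll-correct evs)

-- The bound on the value keeps it among the elements whose colour is already decided.
opaque
  convergent : ℕ → ℕ → ℕ → Bool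
  convergent c x s = (0 <ᵇ output c x s) ∧ (pred (output c x s) <ᵇ s)

  value : ℕ → ℕ → ℕ → ℕ
  value c x s = pred (output c x s)

  convergentᵖ : Prim M → Prim N → Prim O → PrimBool (λ ρ → convergent (M ρ) (N ρ) (O ρ))
  convergentᵖ c x s = (zeroᵖ <ᵖ outputᵖ c x s) ∧ᵖ (predᵖ (outputᵖ c x s) <ᵖ s)

  valueᵖ : Prim M → Prim N → Prim O → Prim (λ ρ → value (M ρ) (N ρ) (O ρ))
  valueᵖ c x s = predᵖ (outputᵖ c x s)

  private
    output-mono* : ∀ c x {s t} v → s ≤′ t → output c x s ≡ suc v → output c x t ≡ suc v
    output-mono* c x v ≤′-refl     eq = eq
    output-mono* c x v (≤′-step p) eq = output-mono c x _ v (output-mono* c x v p eq)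

  convergent-value : ∀ c x {s t v} → output c x t ≡ suc v → convergent c x s ≡ true → value c x s ≡ v × v < s
  convergent-value c x {s} {t} {v} eq conv with output c x s in eq′
  ... | suc v′ with ≤-total s t
  ... | inj₁ s≤t with trans (sym eq) (output-mono* c x v′ (≤⇒≤′ s≤t) eq′)
  ... | refl = refl , <ᵇ⇒< v s (subst T (sym conv) tt)
  convergent-value c x {s} {t} {v} eq conv | suc v′ | inj₂ t≤s
    with trans (sym eq′) (output-mono* c x v (≤⇒≤′ t≤s) eq)
  ... | refl = refl , <ᵇ⇒< v s (subst T (sym conv) tt)

  output-convergent : ∀ c x {s t v} → output c x t ≡ suc v → t ≤ s → v < s → convergent c x s ≡ true
  output-convergent c x {s} {t} {v} eq t≤s v<s
    rewrite output-mono* c x v (≤⇒≤′ t≤s) eq with v <ᵇ s | <⇒<ᵇ v<s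
  ... | true | _ = refl

universal : ∀ {f} → Computable f → ∃ λ c → ∀ x → ∃ λ s → output c x s ≡ suc (f x)
universal (c , ev) = compile c , λ x → output-complete (compile-correct (ev x))

-- The construction

-- An entry records what requirement req does with the element tgt and the chain new:
-- tag 1 creates new as a copy of the tail of tgt, tag 2 merges the copy with the original,
-- tag 3 lets it escape, and tag 0 does nothing.
opaque
  entry : (τ e u w : ℕ) → ℕ
  entry τ e u w = ⟨ τ , ⟨ e , ⟨ u , w ⟩ ⟩ ⟩

  tag req tgt new : ℕ → ℕ
  tag x = fst x
  req x = fst (snd x)
  tgt x = fst (snd (snd x))
  new x = snd (snd (snd x))

  entryᵖ : Prim F → Prim G → Prim H → Prim M → Prim (λ ρ → entry (F ρ) (G ρ) (H ρ) (M ρ))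
  entryᵖ τ e u w = ⟨ τ , ⟨ e , ⟨ u , w ⟩ᵖ ⟩ᵖ ⟩ᵖ

  tagᵖ : Prim F → Prim (tag ∘ F)
  tagᵖ = fstᵖ

  reqᵖ : Prim F → Prim (req ∘ F)
  reqᵖ = fstᵖ ∘ sndᵖ

  tgtᵖ : Prim F → Prim (tgt ∘ F)
  tgtᵖ = fstᵖ ∘ sndᵖ ∘ sndᵖ

  newᵖ : Prim F → Prim (new ∘ F)
  newᵖ = sndᵖ ∘ sndᵖ ∘ sndᵖ

opaque
  len : ℕ → ℕ
  len L = fst L

  push : ℕ → ℕ → ℕ
  push x L = ⟨ suc (len L) , ⟨ x , snd L ⟩ ⟩

  -- The newest entry is stored first, hence the reversed index. The default 0 has tag 0, so
  -- positions outside the log look like idle stages.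
  ent : ℕ → ℕ → ℕ
  ent L t = if t <ᵇ len L then fst (fold (snd L) snd (len L ∸ suc t)) else 0

  lenᵖ : Prim F → Prim (len ∘ F)
  lenᵖ = fstᵖ

  pushᵖ : Prim F → Prim G → Prim (λ ρ → push (F ρ) (G ρ))
  pushᵖ x L = ⟨ sucᵖ (lenᵖ L) , ⟨ x , sndᵖ L ⟩ᵖ ⟩ᵖ

  entᵖ : Prim F → Prim G → Prim (λ ρ → ent (F ρ) (G ρ))
  entᵖ L t = ifᵖ (t <ᵖ lenᵖ L) (fstᵖ (foldᵖ {f = λ _ → snd} (sndᵖ L) (sndᵖ headᵖ) (lenᵖ L ∸ᵖ sucᵖ t))) zeroᵖ

-- A number codes the element at position ps x of chain ch x; ⊕ is the shift along a chain.
opaque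
  ch ps : ℕ → ℕ
  ch = fst
  ps = snd

  infixl 6 _⊕_
  _⊕_ : ℕ → ℕ → ℕ
  x ⊕ k = ⟨ ch x , ps x + k ⟩

  start : ℕ → ℕ
  start w = ⟨ w , 0 ⟩

  chᵖ : Prim F → Prim (ch ∘ F)
  chᵖ = fstᵖ

  psᵖ : Prim F → Prim (ps ∘ F)
  psᵖ = sndᵖ

  ⊕ᵖ : Prim F → Prim G → Prim (λ ρ → F ρ ⊕ G ρ)
  ⊕ᵖ x k = ⟨ chᵖ x , psᵖ x +ᵖ k ⟩ᵖ

  startᵖ : Prim F → Prim (start ∘ F)
  startᵖ w = ⟨ w , zeroᵖ ⟩ᵖ

opaque
  -- A chain is named after the stage that creates it, so entry `j` describes chain `j`. The bound
  -- on the target makes every walk descend in an arbitrary log, and no invariant of logs has to be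
  -- carried along.
  created : ℕ → ℕ → Bool
  created L j = (tag (ent L j) ≡ᵇ 1) ∧ (tgt (ent L j) <ᵇ j)

  happened : ℕ → ℕ → ℕ → ℕ → Bool
  happened L τ j k = some (λ t → (tag (ent L t) ≡ᵇ τ) ∧ (new (ent L t) ≡ᵇ j)) k

  -- A merge takes effect on the whole chain at once. An escape counts only for those `x` whose
  -- `ch x + ps x` is at least its stage, since the other colours may already have been read.
  merged copies : ℕ → ℕ → Bool
  merged L x = created L (ch x) ∧ happened L 2 (ch x) (len L)
  copies L x = created L (ch x) ∧ not (happened L 3 (ch x) (suc (ch x + ps x)))

  down : ℕ → ℕ → ℕ
  down L x = tgt (ent L (ch x)) ⊕ ps x

  createdᵖ : Prim F → Prim G → PrimBool (λ ρ → created (F ρ) (G ρ))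
  createdᵖ L j = (tagᵖ (entᵖ L j) ≡ᵖ constᵖ 1) ∧ᵖ (tgtᵖ (entᵖ L j) <ᵖ j)

  happenedᵖ : Prim F → Prim G → Prim H → Prim M → PrimBool (λ ρ → happened (F ρ) (G ρ) (H ρ) (M ρ))
  happenedᵖ {F = F} {G} {H} L τ j k =
    someᵖ {p = λ ρ t → (tag (ent (F ρ) t) ≡ᵇ G ρ) ∧ (new (ent (F ρ) t) ≡ᵇ H ρ)}
      ((tagᵖ (entᵖ (weaken L) headᵖ) ≡ᵖ weaken τ) ∧ᵖ (newᵖ (entᵖ (weaken L) headᵖ) ≡ᵖ weaken j)) k

  mergedᵖ : Prim F → Prim G → PrimBool (λ ρ → merged (F ρ) (G ρ))
  mergedᵖ L x = createdᵖ L (chᵖ x) ∧ᵖ happenedᵖ L (constᵖ 2) (chᵖ x) (lenᵖ L)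

  copiesᵖ : Prim F → Prim G → PrimBool (λ ρ → copies (F ρ) (G ρ))
  copiesᵖ L x = createdᵖ L (chᵖ x) ∧ᵖ notᵖ (happenedᵖ L (constᵖ 3) (chᵖ x) (sucᵖ (chᵖ x +ᵖ psᵖ x)))

  downᵖ : Prim F → Prim G → Prim (λ ρ → down (F ρ) (G ρ))
  downᵖ L x = ⊕ᵖ (tgtᵖ (entᵖ L (chᵖ x))) (psᵖ x)

-- The chain decreases along d, so ch x rounds suffice.
walk : (ℕ → Bool) → (ℕ → ℕ) → ℕ → ℕ
walk p d x = fold x (λ y → if p y then d y else y) (ch x)

opaque
  -- Two walks along the same edges: the one through merged chains yields canonical representatives,
  -- the one through copying chains finds the element whose chain decides the colour.
  nf origin : ℕ → ℕ → ℕ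
  nf L     = walk (merged L) (down L)
  origin L = walk (copies L) (down L)

  nfᵖ : Prim F → Prim G → Prim (λ ρ → nf (F ρ) (G ρ))
  nfᵖ {F = F} L x = foldᵖ {f = λ ρ y → if merged (F ρ) y then down (F ρ) y else y} x
    (ifᵖ (mergedᵖ (weaken L) headᵖ) (downᵖ (weaken L) headᵖ) headᵖ) (chᵖ x)

  originᵖ : Prim F → Prim G → Prim (λ ρ → origin (F ρ) (G ρ))
  originᵖ {F = F} L x = foldᵖ {f = λ ρ y → if copies (F ρ) y then down (F ρ) y else y} x
    (ifᵖ (copiesᵖ (weaken L) headᵖ) (downᵖ (weaken L) headᵖ) headᵖ) (chᵖ x)

-- The side says which of the two relations the program should fail to reduce to itself.
-- Kind true attacks u when the image of u is not equivalent to u, kind false when it is not in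
-- the forward orbit of u under the shift.
opaque
  side kind : ℕ → Bool
  side e = fst (fst e) ≡ᵇ 0
  kind e = snd (fst e) ≡ᵇ 0

  program : ℕ → ℕ
  program e = snd e

  sideᵖ : Prim F → PrimBool (side ∘ F)
  sideᵖ e = fstᵖ (fstᵖ e) ≡ᵖ zeroᵖ

  kindᵖ : Prim F → PrimBool (kind ∘ F)
  kindᵖ e = sndᵖ (fstᵖ e) ≡ᵖ zeroᵖ

  programᵖ : Prim F → Prim (program ∘ F)
  programᵖ = sndᵖ

-- A walk that copies colours stops at an escaped chain, or at one that copies nothing.
opaque
  colourAt : ℕ → ℕ → Bool
  colourAt L j = if created L j then not (side (req (ent L j))) else true

  colourAtᵖ : Prim F → Prim G → PrimBool (λ ρ → colourAt (F ρ) (G ρ))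
  colourAtᵖ L j = ifᵇ (createdᵖ L j) (notᵖ (sideᵖ (reqᵖ (entᵖ L j)))) (constᵇ true)

opaque
  colour : ℕ → ℕ → Bool
  colour L x = colourAt L (ch (origin L x))

  colourᵖ : Prim F → Prim G → PrimBool (λ ρ → colour (F ρ) (G ρ))
  colourᵖ L x = colourAtᵖ L (chᵖ (originᵖ L x))

same : Bool → Bool → Bool
same b c = if b then c else not c

opaque
  real : ℕ → Bool → ℕ → Bool
  real L b x = same (colour L x) b

  realᵖ : Prim F → PrimBool A → Prim G → PrimBool (λ ρ → real (F ρ) (A ρ) (G ρ))
  realᵖ L b x = ifᵇ (colourᵖ L x) b (notᵖ b)

opaque
  eqv : ℕ → Bool → ℕ → ℕ → Bool
  eqv L b x y = if real L b x then real L b y ∧ (nf L x ≡ᵇ nf L y) else not (real L b y)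

  forward : ℕ → ℕ → ℕ → Bool
  forward L u v = (ch (nf L u) ≡ᵇ ch (nf L v)) ∧ not (ps (nf L v) <ᵇ ps (nf L u))

  eqvᵖ : Prim F → PrimBool A → Prim G → Prim H → PrimBool (λ ρ → eqv (F ρ) (A ρ) (G ρ) (H ρ))
  eqvᵖ L b x y = ifᵇ (realᵖ L b x) (realᵖ L b y ∧ᵖ (nfᵖ L x ≡ᵖ nfᵖ L y)) (notᵖ (realᵖ L b y))

  forwardᵖ : Prim F → Prim G → Prim H → PrimBool (λ ρ → forward (F ρ) (G ρ) (H ρ))
  forwardᵖ L u v = (chᵖ (nfᵖ L u) ≡ᵖ chᵖ (nfᵖ L v)) ∧ᵖ notᵖ (psᵖ (nfᵖ L v) <ᵖ psᵖ (nfᵖ L u))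

opaque
  settled : ℕ → ℕ → ℕ → ℕ → Bool
  settled e L u v = if kind e then eqv L (side e) u v else real L (side e) v ∧ forward L u v

  settledᵖ : Prim F → Prim G → Prim H → Prim M → PrimBool (λ ρ → settled (F ρ) (G ρ) (H ρ) (M ρ))
  settledᵖ e L u v = ifᵇ (kindᵖ e) (eqvᵖ L (sideᵖ e) u v) (realᵖ L (sideᵖ e) v ∧ᵖ forwardᵖ L u v)

-- The strategies and their priority

opaque
  halts : ℕ → ℕ → ℕ → Bool
  halts e L x = convergent (program e) x (len L)

  φ : ℕ → ℕ → ℕ → ℕ
  φ e L x = value (program e) x (len L)

  haltsᵖ : Prim F → Prim G → Prim H → PrimBool (λ ρ → halts (F ρ) (G ρ) (H ρ))
  haltsᵖ e L x = convergentᵖ (programᵖ e) x (lenᵖ L)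

  φᵖ : Prim F → Prim G → Prim H → Prim (λ ρ → φ (F ρ) (G ρ) (H ρ))
  φᵖ e L x = valueᵖ (programᵖ e) x (lenᵖ L)

opaque
  attackable : ℕ → ℕ → ℕ → Bool
  attackable e L u = real L (side e) u ∧ halts e L u ∧ not (settled e L u (φ e L u))

  create : ℕ → ℕ → ℕ
  create e L = first (λ u → if attackable e L u then entry 1 e u (len L) else 0) (len L)

  attackableᵖ : Prim F → Prim G → Prim H → PrimBool (λ ρ → attackable (F ρ) (G ρ) (H ρ))
  attackableᵖ e L u = realᵖ L (sideᵖ e) u ∧ᵖ haltsᵖ e L u ∧ᵖ notᵖ (settledᵖ e L u (φᵖ e L u))

  createᵖ : Prim F → Prim G → Prim (λ ρ → create (F ρ) (G ρ))
  createᵖ {F = F} {G} e L =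
    firstᵖ {g = λ ρ u → if attackable (F ρ) (G ρ) u then entry 1 (F ρ) u (len (G ρ)) else 0}
      (ifᵖ (attackableᵖ (weaken e) (weaken L) headᵖ) (entryᵖ (constᵖ 1) (weaken e) headᵖ (lenᵖ (weaken L))) zeroᵖ)
      (lenᵖ L)

opaque
  -- The merge is tried on a hypothetical log: it is carried out only if the two images would still
  -- be inequivalent after it.
  resolve : ℕ → ℕ → ℕ → ℕ → ℕ
  resolve e L u w =
    if halts e L u ∧ halts e L (start w)
    then (if eqv (push (entry 2 e u w) L) (side e) (φ e L u) (φ e L (start w))
          then entry 3 e u w else entry 2 e u w)
    else 0

  resolveᵖ : Prim F → Prim G → Prim H → Prim M → Prim (λ ρ → resolve (F ρ) (G ρ) (H ρ) (M ρ))
  resolveᵖ e L u w =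
    ifᵖ (haltsᵖ e L u ∧ᵖ haltsᵖ e L (startᵖ w))
      (ifᵖ (eqvᵖ (pushᵖ (entryᵖ (constᵖ 2) e u w) L) (sideᵖ e) (φᵖ e L u) (φᵖ e L (startᵖ w)))
        (entryᵖ (constᵖ 3) e u w) (entryᵖ (constᵖ 2) e u w))
      zeroᵖ

opaque
  -- The value 0 for a stronger `req x` is the injury: the attack of `e` is abandoned, and `e` has
  -- to start again with a new chain.
  update : ℕ → ℕ → ℕ → ℕ
  update e x c = if tag x ≡ᵇ 0 then c else if req x ≡ᵇ e then x else if req x <ᵇ e then 0 else c

  updateᵖ : Prim F → Prim G → Prim H → Prim (λ ρ → update (F ρ) (G ρ) (H ρ))
  updateᵖ e x c = ifᵖ (tagᵖ x ≡ᵖ zeroᵖ) c (ifᵖ (reqᵖ x ≡ᵖ e) x (ifᵖ (reqᵖ x <ᵖ e) zeroᵖ c))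

opaque
  -- The last entry of requirement e since a stronger requirement acted.
  current : ℕ → ℕ → ℕ
  current e L = primrec 0 (λ t c → update e (ent L t) c) (len L)

  currentᵖ : Prim F → Prim G → Prim (λ ρ → current (F ρ) (G ρ))
  currentᵖ {F = F} {G} e L = primrecᵖ {f = λ ρ t c → update (F ρ) (ent (G ρ) t) c} zeroᵖ
    (updateᵖ (weaken (weaken e)) (entᵖ (weaken (weaken L)) headᵖ) (weaken headᵖ)) (lenᵖ L)

opaque
  wants : ℕ → ℕ → ℕ
  wants e L = let x = current e L in
    if tag x ≡ᵇ 0 then create e L else if tag x ≡ᵇ 1 then resolve e L (tgt x) (new x) else 0

  wantsᵖ : Prim F → Prim G → Prim (λ ρ → wants (F ρ) (G ρ))
  wantsᵖ e L = let x = currentᵖ e L in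
    ifᵖ (tagᵖ x ≡ᵖ zeroᵖ) (createᵖ e L) (ifᵖ (tagᵖ x ≡ᵖ constᵖ 1) (resolveᵖ e L (tgtᵖ x) (newᵖ x)) zeroᵖ)

opaque
  act : ℕ → ℕ
  act L = first (λ e → wants e L) (len L)

  actᵖ : Prim F → Prim (act ∘ F)
  actᵖ {F = F} L = firstᵖ {g = λ ρ e → wants e (F ρ)} (wantsᵖ headᵖ (weaken L)) (lenᵖ L)

opaque
  log : ℕ → ℕ
  log zero    = ⟨ 0 , 0 ⟩
  log (suc s) = push (act (log s)) (log s)

  logᵖ : Prim F → Prim (log ∘ F)
  logᵖ {F = F} s = Prim-cong (λ ρ → lemma (F ρ))
    (foldᵖ {f = λ _ L → push (act L) L} ⟨ zeroᵖ , zeroᵖ ⟩ᵖ (pushᵖ (actᵖ headᵖ) headᵖ) s)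
    where
    lemma : ∀ s → fold ⟨ 0 , 0 ⟩ (λ L → push (act L) L) s ≡ log s
    lemma zero    = refl
    lemma (suc s) rewrite lemma s = refl

-- Booleans and bounded search

∧-elim : ∀ {a b} → a ∧ b ≡ true → a ≡ true × b ≡ true
∧-elim {true} {true} _ = refl , refl

∧-intro : ∀ {a b} → a ≡ true → b ≡ true → a ∧ b ≡ true
∧-intro refl refl = refl

not-elim : ∀ {a} → not a ≡ true → a ≡ false
not-elim {false} _ = refl

≡ᵇ-elim : ∀ {m n} → (m ≡ᵇ n) ≡ true → m ≡ n
≡ᵇ-elim {m} {n} eq = ≡ᵇ⇒≡ m n (subst T (sym eq) tt)

≡ᵇ-intro : ∀ {m n} → m ≡ n → (m ≡ᵇ n) ≡ true
≡ᵇ-intro {zero}  refl = refl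
≡ᵇ-intro {suc m} refl = ≡ᵇ-intro {m} refl

≡ᵇ-false : ∀ {m n} → m ≢ n → (m ≡ᵇ n) ≡ false
≡ᵇ-false ne = ¬-not (ne ∘ ≡ᵇ-elim)

<ᵇ-elim : ∀ {m n} → (m <ᵇ n) ≡ true → m < n
<ᵇ-elim {m} {n} eq = <ᵇ⇒< m n (subst T (sym eq) tt)

<ᵇ-intro : ∀ {m n} → m < n → (m <ᵇ n) ≡ true
<ᵇ-intro {m} {n} lt with m <ᵇ n | <⇒<ᵇ lt
... | true | _ = refl

<ᵇ-false : ∀ {m n} → n ≤ m → (m <ᵇ n) ≡ false
<ᵇ-false le = ¬-not (λ eq → <⇒≱ (<ᵇ-elim eq) le)

true≢false : true ≢ false
true≢false ()

same-elim : ∀ {a b} → same a b ≡ true → a ≡ b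
same-elim {true}  {true}  _ = refl
same-elim {false} {false} _ = refl

same-intro : ∀ {a b} → a ≡ b → same a b ≡ true
same-intro {true}  refl = refl
same-intro {false} refl = refl

first-elim : ∀ g k → first g k ≢ 0 → ∃ λ i → i < k × first g k ≡ g i × (∀ j → j < i → g j ≡ 0)
first-intro : ∀ g {k i} → i < k → g i ≢ 0 → first g k ≢ 0

first-elim g zero    ne = ⊥-elim (ne refl)
first-elim g (suc k) ne with first g k in eq
... | suc v with first-elim g k (λ z → ⊥-elim (0≢suc (trans (sym z) eq)))
  where
  0≢suc : 0 ≢ suc v
  0≢suc ()
... | i , i<k , hit , least = i , ≤-trans i<k (n≤1+n k) , trans (sym eq) hit , least
first-elim g (suc k) ne | zero = k , ≤-refl , refl , before
  where
  before : ∀ j → j < k → g j ≡ 0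
  before j j<k with g j in gj
  ... | zero  = refl
  ... | suc v = ⊥-elim (first-intro g j<k (λ z → 0≢suc (trans (sym z) gj)) eq)
    where
    0≢suc : 0 ≢ suc v
    0≢suc ()

first-intro g {suc k} {i} (s≤s i≤k) ne eq with first g k in fk
... | zero with m≤n⇒m<n∨m≡n i≤k
... | inj₁ i<k  = first-intro g i<k ne fk
... | inj₂ refl = ne eq

some-elim : ∀ p k → some p k ≡ true → ∃ λ i → i < k × p i ≡ true
some-elim p k eq with first (bit ∘ p) k in fk
... | suc v with first-elim (bit ∘ p) k (λ z → 0≢suc (trans (sym z) fk))
  where
  0≢suc : 0 ≢ suc v
  0≢suc ()
... | i , i<k , hit , _ with p i in pi
... | true  = i , i<k , pi
... | false with () ← trans (sym fk) hit

some-intro : ∀ p {k i} → i < k → p i ≡ true → some p k ≡ true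
some-intro p {k} i<k pi with first (bit ∘ p) k in fk
... | suc v = refl
... | zero  = ⊥-elim (first-intro (bit ∘ p) i<k (λ z → 1≢0 (trans (sym (cong bit pi)) z)) fk)
  where
  1≢0 : 1 ≢ 0
  1≢0 ()

-- Logs

infix 4 _⊑_
record _⊑_ (L L′ : ℕ) : Set where
  constructor extends
  field
    len-≤ : len L ≤ len L′
    ent-≡ : ∀ {t} → t < len L → ent L′ t ≡ ent L t
open _⊑_ public

opaque
  unfolding entry
  tag-entry : ∀ τ e u w → tag (entry τ e u w) ≡ τ
  tag-entry τ e u w = fst-pair _ _

  req-entry : ∀ τ e u w → req (entry τ e u w) ≡ e
  req-entry τ e u w rewrite snd-pair τ ⟨ e , ⟨ u , w ⟩ ⟩ = fst-pair _ _

  tgt-entry : ∀ τ e u w → tgt (entry τ e u w) ≡ u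
  tgt-entry τ e u w rewrite snd-pair τ ⟨ e , ⟨ u , w ⟩ ⟩ | snd-pair e ⟨ u , w ⟩ = fst-pair _ _

  new-entry : ∀ τ e u w → new (entry τ e u w) ≡ w
  new-entry τ e u w rewrite snd-pair τ ⟨ e , ⟨ u , w ⟩ ⟩ | snd-pair e ⟨ u , w ⟩ = snd-pair _ _

  tag-0 : tag 0 ≡ 0
  tag-0 = fst-zero

opaque
  unfolding ent log
  len-push : ∀ x L → len (push x L) ≡ suc (len L)
  len-push x L = fst-pair _ _

  ent-push-old : ∀ x L {t} → t < len L → ent (push x L) t ≡ ent L t
  ent-push-old x L {t} t<
    rewrite len-push x L | <ᵇ-intro t< | <ᵇ-intro (≤-trans t< (n≤1+n (len L)))
          | snd-pair (suc (len L)) ⟨ x , snd L ⟩ | +-∸-assoc 1 t<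
          | fold-suc snd ⟨ x , snd L ⟩ (len L ∸ suc t) | snd-pair x (snd L) = refl

  ent-push-new : ∀ x L → ent (push x L) (len L) ≡ x
  ent-push-new x L rewrite len-push x L | <ᵇ-intro (n<1+n (len L)) | n∸n≡0 (len L)
    | snd-pair (suc (len L)) ⟨ x , snd L ⟩ = fst-pair _ _

  ent-outside : ∀ L {t} → len L ≤ t → ent L t ≡ 0
  ent-outside L le rewrite <ᵇ-false le = refl

  len-log : ∀ s → len (log s) ≡ s
  len-log zero    = fst-pair _ _
  len-log (suc s) = trans (len-push _ _) (cong suc (len-log s))

  log-suc : ∀ s → log (suc s) ≡ push (act (log s)) (log s)
  log-suc s = refl

⊑-push : ∀ x L → L ⊑ push x L
⊑-push x L = extends (≤-trans (n≤1+n _) (≤-reflexive (sym (len-push x L)))) (ent-push-old x L)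

⊑-refl : ∀ {L} → L ⊑ L
⊑-refl = extends ≤-refl (λ _ → refl)

⊑-trans : ∀ {L M N} → L ⊑ M → M ⊑ N → L ⊑ N
⊑-trans (extends l e) (extends l′ e′) = extends (≤-trans l l′) (λ t< → trans (e′ (≤-trans t< l)) (e t<))

log-⊑ : ∀ {s t} → s ≤ t → log s ⊑ log t
log-⊑ {s} s≤t = go (≤⇒≤′ s≤t)
  where
  go : ∀ {t} → s ≤′ t → log s ⊑ log t
  go ≤′-refl     = ⊑-refl
  go (≤′-step {t} p) = ⊑-trans (go p) (subst (log t ⊑_) (sym (log-suc t)) (⊑-push _ _))

history : ℕ → ℕ
history s = act (log s)

ent-log : ∀ {s t} → t < s → ent (log s) t ≡ history t
ent-log {s} {t} t<s = trans
  (ent-≡ (log-⊑ t<s) (subst (t <_) (sym (len-log (suc t))) ≤-refl))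
  (trans (cong₂ ent (log-suc t) (sym (len-log t))) (ent-push-new (act (log t)) (log t)))

ent-tag : ∀ {L t τ} → tag (ent L t) ≡ suc τ → t < len L
ent-tag {L} {t} eq = ≰⇒> λ le → 0≢suc (trans (sym tag-0) (trans (cong tag (sym (ent-outside L le))) eq))
  where
  0≢suc : ∀ {n} → 0 ≢ suc n
  0≢suc ()

-- Elements

opaque
  unfolding ch
  ch-⊕ : ∀ x k → ch (x ⊕ k) ≡ ch x
  ch-⊕ x k = fst-pair _ _

  ps-⊕ : ∀ x k → ps (x ⊕ k) ≡ ps x + k
  ps-⊕ x k = snd-pair _ _

  ch-start : ∀ w → ch (start w) ≡ w
  ch-start w = fst-pair _ _

  ps-start : ∀ w → ps (start w) ≡ 0
  ps-start w = snd-pair _ _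

  element-ext : ∀ {x y} → ch x ≡ ch y → ps x ≡ ps y → x ≡ y
  element-ext {x} {y} p q = trans (sym (pair-surjective x)) (trans (cong₂ ⟨_,_⟩ p q) (pair-surjective y))

  ch+ps≤ : ∀ x → ch x + ps x ≤ x
  ch+ps≤ = fst+snd≤

⊕-⊕ : ∀ x j k → x ⊕ j ⊕ k ≡ x ⊕ (j + k)
⊕-⊕ x j k = element-ext
  (trans (ch-⊕ _ k) (trans (ch-⊕ x j) (sym (ch-⊕ x _))))
  (trans (ps-⊕ _ k) (trans (cong (_+ k) (ps-⊕ x j)) (trans (+-assoc (ps x) j k) (sym (ps-⊕ x _)))))

⊕-0 : ∀ x → x ⊕ 0 ≡ x
⊕-0 x = element-ext (ch-⊕ x 0) (trans (ps-⊕ x 0) (+-identityʳ _))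

start-⊕ : ∀ x → start (ch x) ⊕ ps x ≡ x
start-⊕ x = element-ext (trans (ch-⊕ _ _) (ch-start _)) (trans (ps-⊕ _ _) (cong (_+ ps x) (ps-start _)))

ch≤ : ∀ x → ch x ≤ x
ch≤ x = ≤-trans (m≤m+n _ _) (ch+ps≤ x)

chain-induction : (P : ℕ → Set) → (∀ x → (∀ y → ch y < ch x → P y) → P x) → ∀ x → P x
chain-induction P ih x = go x (<-wellFounded (ch x))
  where
  go : ∀ x → Acc _<_ (ch x) → P x
  go x (acc rs) = ih x λ y y<x → go y (rs y<x)

module Walk (p : ℕ → Bool) (d : ℕ → ℕ) (d< : ∀ x → p x ≡ true → ch (d x) < ch x) where
  private
    f : ℕ → ℕ
    f y = if p y then d y else y

    stuck : ∀ x n → p x ≡ false → fold x f n ≡ x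
    stuck x zero    eq = refl
    stuck x (suc n) eq = trans (cong f (stuck x n eq)) lemma
      where
      lemma : f x ≡ x
      lemma rewrite eq = refl

    go : ∀ x n → p x ≡ true → fold x f (suc n) ≡ fold (d x) f n
    go x n eq = trans (fold-suc f x n) (cong (λ y → fold y f n) lemma)
      where
      lemma : f x ≡ d x
      lemma rewrite eq = refl

    absurd : ∀ {x} → ch x ≤ 0 → p x ≡ true → ⊥
    absurd c≤0 px = <⇒≱ (d< _ px) (≤-trans c≤0 z≤n)

    -- A step along `d` changes the number `ch x` of rounds, so the equation for a step needs any
    -- two sufficient numbers of rounds to agree.
    enough : ∀ m n x → ch x ≤ m → ch x ≤ n → fold x f m ≡ fold x f n
    enough m n x a b with p x in px
    enough m n x a b | false = trans (stuck x m px) (sym (stuck x n px))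
    enough zero n x a b | true = ⊥-elim (absurd a px)
    enough (suc m) zero x a b | true = ⊥-elim (absurd b px)
    enough (suc m) (suc n) x a b | true = trans (go x m px) (trans
      (enough m n (d x) (≤-pred (≤-trans (d< x px) a)) (≤-pred (≤-trans (d< x px) b))) (sym (go x n px)))

  walk-stop : ∀ {x} → p x ≡ false → walk p d x ≡ x
  walk-stop {x} = stuck x (ch x)

  walk-go : ∀ {x} → p x ≡ true → walk p d x ≡ walk p d (d x)
  walk-go {x} px = trans (enough (ch x) (suc (ch x)) x ≤-refl (n≤1+n _))
    (trans (go x (ch x) px) (enough (ch x) (ch (d x)) (d x) (<⇒≤ (d< x px)) ≤-refl))

-- Normal forms and colours

opaque
  unfolding created
  created-elim : ∀ {L j} → created L j ≡ true → tag (ent L j) ≡ 1 × tgt (ent L j) < j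
  created-elim eq with ∧-elim eq
  ... | a , b = ≡ᵇ-elim a , <ᵇ-elim b

  created-intro : ∀ {L j} → tag (ent L j) ≡ 1 → tgt (ent L j) < j → created L j ≡ true
  created-intro a b = ∧-intro (≡ᵇ-intro a) (<ᵇ-intro b)

  happened-elim : ∀ {L τ j k} → happened L τ j k ≡ true → ∃ λ t → t < k × tag (ent L t) ≡ τ × new (ent L t) ≡ j
  happened-elim {L} {τ} {j} {k} eq with some-elim _ k eq
  ... | t , t<k , h with ∧-elim h
  ... | a , b = t , t<k , ≡ᵇ-elim a , ≡ᵇ-elim b

  happened-intro : ∀ {L τ j k t} → t < k → tag (ent L t) ≡ τ → new (ent L t) ≡ j → happened L τ j k ≡ true
  happened-intro t<k a b = some-intro _ t<k (∧-intro (≡ᵇ-intro a) (≡ᵇ-intro b))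

  merged-elim : ∀ {L x} → merged L x ≡ true → created L (ch x) ≡ true × happened L 2 (ch x) (len L) ≡ true
  merged-elim = ∧-elim

  merged-intro : ∀ {L x} → created L (ch x) ≡ true → happened L 2 (ch x) (len L) ≡ true → merged L x ≡ true
  merged-intro = ∧-intro

  copies-elim : ∀ {L x} → copies L x ≡ true → created L (ch x) ≡ true × happened L 3 (ch x) (suc (ch x + ps x)) ≡ false
  copies-elim eq with ∧-elim eq
  ... | a , b = a , not-elim b

  copies-intro : ∀ {L x} → created L (ch x) ≡ true → happened L 3 (ch x) (suc (ch x + ps x)) ≡ false → copies L x ≡ true
  copies-intro a b = ∧-intro a (cong not b)

  ch-down : ∀ L x → ch (down L x) ≡ ch (tgt (ent L (ch x)))
  ch-down L x = ch-⊕ _ _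

  ps-down : ∀ L x → ps (down L x) ≡ ps (tgt (ent L (ch x))) + ps x
  ps-down L x = ps-⊕ _ _

  down-⊕ : ∀ L x k → down L (x ⊕ k) ≡ down L x ⊕ k
  down-⊕ L x k rewrite ch-⊕ x k | ps-⊕ x k = sym (⊕-⊕ _ _ _)

  down-cong : ∀ {L L′ x} → ent L′ (ch x) ≡ ent L (ch x) → down L′ x ≡ down L x
  down-cong {x = x} eq = cong (λ n → tgt n ⊕ ps x) eq

  merged-cong : ∀ {L x y} → ch x ≡ ch y → merged L x ≡ merged L y
  merged-cong {L} eq = cong (λ j → created L j ∧ happened L 2 j (len L)) eq

created-< : ∀ {L j} → created L j ≡ true → j < len L
created-< cr = ent-tag (proj₁ (created-elim cr))

created-mono : ∀ {L L′ j} → L ⊑ L′ → created L j ≡ true → created L′ j ≡ true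
created-mono ext cr with created-elim cr | ent-≡ ext (created-< cr)
... | a , b | eq = created-intro (trans (cong tag eq) a) (subst (_< _) (cong tgt (sym eq)) b)

created-back : ∀ {L L′ j} → L ⊑ L′ → j < len L → created L′ j ≡ true → created L j ≡ true
created-back ext j< cr with created-elim cr | ent-≡ ext j<
... | a , b | eq = created-intro (trans (cong tag (sym eq)) a) (subst (_< _) (cong tgt eq) b)

happened-mono : ∀ {L L′ τ j k k′} → L ⊑ L′ → k ≤ len L → k ≤ k′ → happened L τ j k ≡ true → happened L′ τ j k′ ≡ true
happened-mono ext k≤ k≤k′ h with happened-elim h
... | t , t<k , a , b with ent-≡ ext (≤-trans t<k k≤)
... | eq = happened-intro (≤-trans t<k k≤k′) (trans (cong tag eq) a) (trans (cong new eq) b)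

happened-back : ∀ {L L′ τ j k} → L ⊑ L′ → k ≤ len L → happened L′ τ j k ≡ true → happened L τ j k ≡ true
happened-back ext k≤ h with happened-elim h
... | t , t<k , a , b with ent-≡ ext (≤-trans t<k k≤)
... | eq = happened-intro t<k (trans (cong tag (sym eq)) a) (trans (cong new (sym eq)) b)

down-< : ∀ {L x} → created L (ch x) ≡ true → ch (down L x) < ch x
down-< {L} {x} cr = subst (_< ch x) (sym (ch-down L x)) (≤-<-trans (ch≤ _) (proj₂ (created-elim cr)))

merged-mono : ∀ {L L′ x} → L ⊑ L′ → merged L x ≡ true → merged L′ x ≡ true
merged-mono ext m with merged-elim m
... | cr , h = merged-intro (created-mono ext cr) (happened-mono ext ≤-refl (len-≤ ext) h)

module _ (L : ℕ) where
  private
    module N = Walk (merged L) (down L) (λ x m → down-< (proj₁ (merged-elim m)))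
    module O = Walk (copies L) (down L) (λ x m → down-< (proj₁ (copies-elim m)))
  opaque
    unfolding nf colour
    nf-stop : ∀ {x} → merged L x ≡ false → nf L x ≡ x
    nf-stop = N.walk-stop

    nf-go : ∀ {x} → merged L x ≡ true → nf L x ≡ nf L (down L x)
    nf-go = N.walk-go

    colour-stop : ∀ {x} → copies L x ≡ false → colour L x ≡ colourAt L (ch x)
    colour-stop c = cong (colourAt L ∘ ch) (O.walk-stop c)

    colour-go : ∀ {x} → copies L x ≡ true → colour L x ≡ colour L (down L x)
    colour-go c = cong (colourAt L ∘ ch) (O.walk-go c)

-- Whether the walk goes on depends only on the chain, and `down` commutes with the shift. This
-- makes the shift well defined and injective on classes.
nf-⊕ : ∀ L x k → nf L (x ⊕ k) ≡ nf L x ⊕ k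
nf-⊕ L x k = chain-induction (λ x → nf L (x ⊕ k) ≡ nf L x ⊕ k) go x
  where
  go : ∀ x → (∀ y → ch y < ch x → nf L (y ⊕ k) ≡ nf L y ⊕ k) → nf L (x ⊕ k) ≡ nf L x ⊕ k
  go x ih with merged L x in m
  ... | false = trans (nf-stop L (trans (merged-cong (ch-⊕ x k)) m)) (cong (_⊕ k) (sym (nf-stop L m)))
  ... | true  = trans (nf-go L (trans (merged-cong (ch-⊕ x k)) m)) (trans (cong (nf L) (down-⊕ L x k))
    (trans (ih _ (down-< (proj₁ (merged-elim m)))) (cong (_⊕ k) (sym (nf-go L m)))))

ch-nf≤ : ∀ L x → ch (nf L x) ≤ ch x
ch-nf≤ L = chain-induction _ go
  where
  go : ∀ x → (∀ y → ch y < ch x → ch (nf L y) ≤ ch y) → ch (nf L x) ≤ ch x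
  go x ih with merged L x in m
  ... | false = ≤-reflexive (cong ch (nf-stop L m))
  ... | true  = ≤-trans (≤-reflexive (cong ch (nf-go L m)))
    (≤-trans (ih _ d<) (<⇒≤ d<))
    where d< = down-< (proj₁ (merged-elim m))

nf-normal : ∀ L x → merged L (nf L x) ≡ false
nf-normal L = chain-induction _ go
  where
  go : ∀ x → (∀ y → ch y < ch x → merged L (nf L y) ≡ false) → merged L (nf L x) ≡ false
  go x ih with merged L x in m
  ... | false = trans (cong (merged L) (nf-stop L m)) m
  ... | true  = trans (cong (merged L) (nf-go L m)) (ih _ (down-< (proj₁ (merged-elim m))))

-- Old entries never change, so new merges prolong a walk without diverting it.
nf-extend : ∀ {L L′} → L ⊑ L′ → ∀ x → nf L′ x ≡ nf L′ (nf L x)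
nf-extend {L} {L′} ext = chain-induction _ go
  where
  go : ∀ x → (∀ y → ch y < ch x → nf L′ y ≡ nf L′ (nf L y)) → nf L′ x ≡ nf L′ (nf L x)
  go x ih with merged L x in m
  ... | false = cong (nf L′) (sym (nf-stop L m))
  ... | true  = trans (nf-go L′ (merged-mono ext m)) (trans (cong (nf L′) (down-cong (ent-≡ ext (created-< cr))))
    (trans (ih _ (down-< cr)) (cong (nf L′) (sym (nf-go L m)))))
    where cr = proj₁ (merged-elim m)

-- The old normal form lies on a chain at most that of `x`; if no such chain is newly merged, the
-- walk still stops there.
nf-stable : ∀ {L L′} → L ⊑ L′ → ∀ {x} → (∀ y → ch y ≤ ch x → merged L′ y ≡ true → merged L y ≡ true) → nf L′ x ≡ nf L x
nf-stable {L} {L′} ext {x} back = trans (nf-extend ext x)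
  (nf-stop L′ (¬-not λ m → true≢false (trans (sym (back _ (ch-nf≤ L x) m)) (nf-normal L x))))

opaque
  unfolding colourAt
  colourAt-created : ∀ {L j} → created L j ≡ true → colourAt L j ≡ not (side (req (ent L j)))
  colourAt-created cr rewrite cr = refl

  colourAt-uncreated : ∀ {L j} → created L j ≡ false → colourAt L j ≡ true
  colourAt-uncreated cr rewrite cr = refl

colourAt-back : ∀ {L L′ j} → L ⊑ L′ → j < len L → colourAt L′ j ≡ colourAt L j
colourAt-back {L} {L′} {j} ext j< with created L j in cr
... | true  = trans (colourAt-created (created-mono ext cr)) (trans (cong (not ∘ side ∘ req) (ent-≡ ext j<)) (sym (colourAt-created cr)))
... | false = trans (colourAt-uncreated (¬-not λ cr′ → true≢false (trans (sym (created-back ext j< cr′)) cr))) (sym (colourAt-uncreated cr))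

-- Hence the colour of x only depends on the first ch x + ps x + 1 entries of the log.
down-measure : ∀ {L x} → created L (ch x) ≡ true → ch (down L x) + ps (down L x) < ch x + ps x
down-measure {L} {x} cr rewrite ch-down L x | ps-down L x
  | sym (+-assoc (ch (tgt (ent L (ch x)))) (ps (tgt (ent L (ch x)))) (ps x)) =
  -- The coordinates of the target add up to at most its code, and this code is smaller than the
  -- name of the chain.
  +-monoˡ-< (ps x) (≤-<-trans (ch+ps≤ _) (proj₂ (created-elim cr)))

colour-back : ∀ {L L′ x} → L ⊑ L′ → ch x + ps x < len L → colour L′ x ≡ colour L x
colour-back {L} {L′} {x} ext = chain-induction (λ x → ch x + ps x < len L → colour L′ x ≡ colour L x) go x
  where
  go : ∀ x → (∀ y → ch y < ch x → ch y + ps y < len L → colour L′ y ≡ colour L y) →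
       ch x + ps x < len L → colour L′ x ≡ colour L x
  go x ih x< with copies L x in c
  ... | true  = trans (colour-go L′ (copies-intro (created-mono ext cr)
      (¬-not λ h → true≢false (trans (sym (happened-back ext x< h)) (proj₂ (copies-elim c))))))
    (trans (cong (colour L′) (down-cong (ent-≡ ext (created-< cr))))
    (trans (ih _ (down-< cr) (<-trans (down-measure cr) x<)) (sym (colour-go L c))))
    where cr = proj₁ (copies-elim c)
  ... | false = trans (colour-stop L′ (¬-not λ c′ → true≢false (trans (sym (back c′)) c)))
      (trans (colourAt-back ext ch<) (sym (colour-stop L c)))
    where
    ch< = ≤-<-trans (m≤m+n (ch x) (ps x)) x<
    back : copies L′ x ≡ true → copies L x ≡ true
    back c′ with copies-elim c′
    ... | cr , h = copies-intro (created-back ext ch< cr)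
      (¬-not λ h′ → true≢false (trans (sym (happened-mono ext x< ≤-refl h′)) h))

-- Final colours

stage : ℕ → ℕ
stage x = suc (ch x + ps x)

-- The colour is read at the first stage that determines it and is final by `colour-back`. So the
-- colouring is computable, as the map on the join requires.
col : ℕ → Bool
col x = colour (log (stage x)) x

colour-log : ∀ {s} x → ch x + ps x < s → colour (log s) x ≡ col x
colour-log x x< = colour-back (log-⊑ x<) (subst (ch x + ps x <_) (sym (len-log _)) ≤-refl)

colour-log′ : ∀ {s} x → x < s → colour (log s) x ≡ col x
colour-log′ x x<s = colour-log x (≤-<-trans (ch+ps≤ x) x<s)

-- Analysis of the log

data Step (e L x : ℕ) : Set where
  creating : ∀ u → tag (current e L) ≡ 0 → u < len L → attackable e L u ≡ true →
             x ≡ entry 1 e u (len L) → Step e L x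
  merging  : ∀ u w → tag (current e L) ≡ 1 → tgt (current e L) ≡ u → new (current e L) ≡ w →
             halts e L u ≡ true → halts e L (start w) ≡ true →
             eqv (push x L) (side e) (φ e L u) (φ e L (start w)) ≡ false →
             x ≡ entry 2 e u w → Step e L x
  escaping : ∀ u w → tag (current e L) ≡ 1 → tgt (current e L) ≡ u → new (current e L) ≡ w →
             halts e L u ≡ true → halts e L (start w) ≡ true →
             eqv (push (entry 2 e u w) L) (side e) (φ e L u) (φ e L (start w)) ≡ true →
             x ≡ entry 3 e u w → Step e L x

entry≢0 : ∀ {τ e u w} → entry (suc τ) e u w ≢ 0
entry≢0 {τ} {e} {u} {w} eq = 1+n≢0 (trans (sym (tag-entry (suc τ) e u w)) (trans (cong tag eq) tag-0))

tag≢0 : ∀ {x} → tag x ≢ 0 → x ≢ 0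
tag≢0 ne refl = ne tag-0

opaque
  unfolding wants create resolve act
  wants-elim : ∀ e L → wants e L ≢ 0 → Step e L (wants e L)
  wants-elim e L ne with tag (current e L) ≡ᵇ 0 in c0
  ... | true with first-elim _ (len L) ne
  ... | u , u< , hit , _ with attackable e L u in a
  ... | true  = creating u (≡ᵇ-elim c0) u< a hit
  ... | false = ⊥-elim (ne hit)
  wants-elim e L ne | false with tag (current e L) ≡ᵇ 1 in c1
  ... | false = ⊥-elim (ne refl)
  ... | true with halts e L (tgt (current e L)) ∧ halts e L (start (new (current e L))) in h
  ... | false = ⊥-elim (ne refl)
  ... | true with eqv (push (entry 2 e (tgt (current e L)) (new (current e L))) L) (side e)
                    (φ e L (tgt (current e L))) (φ e L (start (new (current e L)))) in q
  ... | true  = escaping _ _ (≡ᵇ-elim c1) refl refl (proj₁ (∧-elim h)) (proj₂ (∧-elim h)) q refl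
  ... | false = merging _ _ (≡ᵇ-elim c1) refl refl (proj₁ (∧-elim h)) (proj₂ (∧-elim h)) q refl

  wants-create : ∀ e L {u} → tag (current e L) ≡ 0 → u < len L → attackable e L u ≡ true → wants e L ≢ 0
  wants-create e L {u} c u< a rewrite c = first-intro _ u< λ eq → entry≢0 (trans (sym lemma) eq)
    where
    lemma : (if attackable e L u then entry 1 e u (len L) else 0) ≡ entry 1 e u (len L)
    lemma rewrite a = refl

  wants-resolve : ∀ e L → tag (current e L) ≡ 1 → halts e L (tgt (current e L)) ≡ true →
                  halts e L (start (new (current e L))) ≡ true → wants e L ≢ 0
  wants-resolve e L c h h′ rewrite c | h | h′
    with eqv (push (entry 2 e (tgt (current e L)) (new (current e L))) L) (side e)
             (φ e L (tgt (current e L))) (φ e L (start (new (current e L))))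
  ... | true  = entry≢0
  ... | false = entry≢0

  act-elim : ∀ L → act L ≢ 0 → ∃ λ e → e < len L × act L ≡ wants e L × (∀ e′ → e′ < e → wants e′ L ≡ 0)
  act-elim L = first-elim (λ e → wants e L) (len L)

  act-intro : ∀ L {e} → e < len L → wants e L ≢ 0 → act L ≢ 0
  act-intro L = first-intro (λ e → wants e L)

step-req : ∀ {e L x} → Step e L x → req x ≡ e
step-req (creating _ _ _ _ eq)         = trans (cong req eq) (req-entry _ _ _ _)
step-req (merging _ _ _ _ _ _ _ _ eq)  = trans (cong req eq) (req-entry _ _ _ _)
step-req (escaping _ _ _ _ _ _ _ _ eq) = trans (cong req eq) (req-entry _ _ _ _)

step-tag : ∀ {e L x} → Step e L x → tag x ≢ 0
step-tag (creating _ _ _ _ eq) z = 1+n≢0 (trans (sym (tag-entry _ _ _ _)) (trans (cong tag (sym eq)) z))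
step-tag (merging _ _ _ _ _ _ _ _ eq) z = 1+n≢0 (trans (sym (tag-entry _ _ _ _)) (trans (cong tag (sym eq)) z))
step-tag (escaping _ _ _ _ _ _ _ _ eq) z = 1+n≢0 (trans (sym (tag-entry _ _ _ _)) (trans (cong tag (sym eq)) z))

step-of : ∀ {t} → tag (history t) ≢ 0 → Step (req (history t)) (log t) (history t)
step-of {t} ne with act-elim (log t) (tag≢0 ne)
... | e , _ , eq , _ with wants-elim e (log t) (λ z → tag≢0 ne (trans eq z))
... | st = subst (λ e → Step e (log t) (history t)) (sym (step-req st′)) st′
  where st′ = subst (Step e (log t)) (sym eq) st

Acts : ℕ → ℕ → Set
Acts e t = tag (history t) ≢ 0 × req (history t) ≤ e

wants-acts : ∀ {e t} → e < t → wants e (log t) ≢ 0 → Acts e t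
wants-acts {e} {t} e<t ne = step-tag st , lemma
  where
  e<len = subst (e <_) (sym (len-log t)) e<t
  a = act-elim (log t) (act-intro (log t) e<len ne)
  st : Step (proj₁ a) (log t) (history t)
  st = subst (Step _ (log t)) (sym (proj₁ (proj₂ (proj₂ a))))
    (wants-elim _ _ (λ z → act-intro (log t) e<len ne (trans (proj₁ (proj₂ (proj₂ a))) z)))
  lemma : req (history t) ≤ e
  lemma = subst (_≤ e) (sym (step-req st)) (≮⇒≥ λ lt → ne (proj₂ (proj₂ (proj₂ a)) e lt))

Quiet : ℕ → ℕ → ℕ → Set
Quiet e s s′ = ∀ t → s ≤ t → t < s′ → tag (history t) ≢ 0 → e < req (history t)

-- Activity in a bounded interval is decidable, which keeps the finite injury argument constructive.
quiet? : ∀ e s s′ → Quiet e s s′ ⊎ ∃ λ t → s ≤ t × t < s′ × Acts e t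
quiet? e s zero = inj₁ λ _ _ ()
quiet? e s (suc s′) with quiet? e s s′
... | inj₂ (t , s≤t , t<s′ , a) = inj₂ (t , s≤t , ≤-trans t<s′ (n≤1+n _) , a)
... | inj₁ q with s ≤? s′
... | no s≰s′ = inj₁ λ t s≤t t<s′ _ → ⊥-elim (s≰s′ (≤-trans s≤t (m<1+n⇒m≤n t<s′)))
... | yes s≤s′ with tag (history s′) ≟ 0 | req (history s′) ≤? e
... | no ne | yes le = inj₂ (s′ , s≤s′ , ≤-refl , ne , le)
... | yes eq | _ = inj₁ λ t s≤t t< ne → go t s≤t (m≤n⇒m<n∨m≡n (m<1+n⇒m≤n t<)) ne
  where
  go : ∀ t → s ≤ t → t < s′ ⊎ t ≡ s′ → tag (history t) ≢ 0 → e < req (history t)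
  go t s≤t (inj₁ t<)   ne = q t s≤t t< ne
  go t s≤t (inj₂ refl) ne = ⊥-elim (ne eq)
... | no _ | no gt = inj₁ λ t s≤t t< ne → go t s≤t (m≤n⇒m<n∨m≡n (m<1+n⇒m≤n t<)) ne
  where
  go : ∀ t → s ≤ t → t < s′ ⊎ t ≡ s′ → tag (history t) ≢ 0 → e < req (history t)
  go t s≤t (inj₁ t<)   ne = q t s≤t t< ne
  go t s≤t (inj₂ refl) ne = ≰⇒> gt

cur : ℕ → ℕ → ℕ
cur e s = current e (log s)

opaque
  unfolding update
  update-idle : ∀ {e x c} → tag x ≡ 0 → update e x c ≡ c
  update-idle eq rewrite eq = refl

  update-own : ∀ {e x c} → tag x ≢ 0 → req x ≡ e → update e x c ≡ x
  update-own ne eq rewrite ≡ᵇ-false ne | ≡ᵇ-intro eq = refl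

  update-reset : ∀ {e x c} → tag x ≢ 0 → req x < e → update e x c ≡ 0
  update-reset ne lt rewrite ≡ᵇ-false ne | ≡ᵇ-false (<⇒≢ lt) | <ᵇ-intro lt = refl

  update-weaker : ∀ {e x c} → tag x ≢ 0 → e < req x → update e x c ≡ c
  update-weaker {e} {x} ne lt rewrite ≡ᵇ-false ne | ≡ᵇ-false (λ eq → <⇒≢ lt (sym eq)) | <ᵇ-false (<⇒≤ lt) = refl

opaque
  unfolding current
  cur-zero : ∀ e → cur e 0 ≡ 0
  cur-zero e rewrite len-log 0 = refl

  cur-suc : ∀ e s → cur e (suc s) ≡ update e (history s) (cur e s)
  cur-suc e s rewrite len-log (suc s) | len-log s = cong₂ (update e) (ent-log ≤-refl) (agree s ≤-refl)
    where
    agree : ∀ k → k ≤ s → primrec 0 (λ t c → update e (ent (log (suc s)) t) c) k ≡ primrec 0 (λ t c → update e (ent (log s) t) c) k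
    agree zero    _   = refl
    agree (suc k) k<s = cong₂ (update e) (trans (ent-log (≤-trans k<s (n≤1+n s))) (sym (ent-log k<s))) (agree k (<⇒≤ k<s))

cur-step : ∀ e s → ¬ Acts e s → cur e (suc s) ≡ cur e s
cur-step e s na with tag (history s) ≟ 0
... | yes eq = trans (cur-suc e s) (update-idle eq)
... | no ne  = trans (cur-suc e s) (update-weaker ne (≰⇒> λ le → na (ne , le)))

cur-quiet : ∀ e {s s′} → s ≤ s′ → Quiet e s s′ → cur e s′ ≡ cur e s
cur-quiet e {zero} {zero} s≤s′ q = refl
cur-quiet e {s} {suc s′} s≤s′ q with m≤n⇒m<n∨m≡n s≤s′
... | inj₂ refl = refl
... | inj₁ (s≤s s≤) = trans (cur-step e s′ λ { (ne , le) → <⇒≱ (q s′ s≤ ≤-refl ne) le })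
  (cur-quiet e s≤ λ t a b → q t a (≤-trans b (n≤1+n s′)))

record Latest (e s : ℕ) : Set where
  constructor latest
  field
    time  : ℕ
    past  : time < s
    entry-is : history time ≡ cur e s
    own   : req (history time) ≡ e
    quiet : Quiet e (suc time) s

cur-latest : ∀ e s → tag (cur e s) ≢ 0 → Latest e s
cur-latest e zero ne = ⊥-elim (ne (trans (cong tag (cur-zero e)) tag-0))
cur-latest e (suc s) ne with tag (history s) ≟ 0 | <-cmp (req (history s)) e
... | no ne′ | tri≈ _ eq _ = latest s ≤-refl (sym (trans (cur-suc e s) (update-own ne′ eq))) eq
      (λ t a b _ → ⊥-elim (<⇒≱ b a))
... | no ne′ | tri< lt _ _ = ⊥-elim (ne (trans (cong tag (trans (cur-suc e s) (update-reset ne′ lt))) tag-0))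
... | yes eq | _ with cur-latest e s (λ z → ne (trans (cong tag (trans (cur-suc e s) (update-idle eq))) z))
... | latest t p i o q = latest t (≤-trans p (n≤1+n s)) (trans i (sym (trans (cur-suc e s) (update-idle eq)))) o
      λ t′ a b ne″ → go t′ a (m≤n⇒m<n∨m≡n (m<1+n⇒m≤n b)) ne″
  where
  go : ∀ t′ → suc t ≤ t′ → t′ < s ⊎ t′ ≡ s → tag (history t′) ≢ 0 → e < req (history t′)
  go t′ a (inj₁ b)    ne = q t′ a b ne
  go t′ a (inj₂ refl) ne = ⊥-elim (ne eq)
cur-latest e (suc s) ne | no ne′ | tri> _ _ gt
  with cur-latest e s (λ z → ne (trans (cong tag (trans (cur-suc e s) (update-weaker ne′ gt))) z))
... | latest t p i o q = latest t (≤-trans p (n≤1+n s)) (trans i (sym (trans (cur-suc e s) (update-weaker ne′ gt)))) o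
      λ t′ a b ne″ → go t′ a (m≤n⇒m<n∨m≡n (m<1+n⇒m≤n b)) ne″
  where
  go : ∀ t′ → suc t ≤ t′ → t′ < s ⊎ t′ ≡ s → tag (history t′) ≢ 0 → e < req (history t′)
  go t′ a (inj₁ b)    ne = q t′ a b ne
  go t′ a (inj₂ refl) ne = gt

record Attack (e u w : ℕ) : Set where
  constructor attacked
  field
    made  : history w ≡ entry 1 e u w
    below : u < w
    cause : attackable e (log w) u ≡ true

record Resolved (τ e u w t : ℕ) : Set where
  constructor resolved
  field
    made   : history t ≡ entry τ e u w
    attack : Attack e u w
    after  : w < t
    quiet  : Quiet e (suc w) t
    halts₁ : halts e (log t) u ≡ true
    halts₂ : halts e (log t) (start w) ≡ true

attack-of : ∀ {e t} → tag (history t) ≡ 1 → req (history t) ≡ e → ∃ λ u → Attack e u t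
attack-of {e} {t} eq refl with step-of (λ z → 1+n≢0 (trans (sym eq) z))
... | creating u _ u< a h = u , attacked (trans h (cong (entry 1 _ u) (len-log t))) (subst (u <_) (len-log t) u<) a
... | merging u w _ _ _ _ _ _ h with () ← trans (sym eq) (trans (cong tag h) (tag-entry 2 _ u w))
... | escaping u w _ _ _ _ _ _ h with () ← trans (sym eq) (trans (cong tag h) (tag-entry 3 _ u w))

current-attack : ∀ {e s u w} → tag (cur e s) ≡ 1 → tgt (cur e s) ≡ u → new (cur e s) ≡ w →
                 Attack e u w × w < s × Quiet e (suc w) s
current-attack {e} {s} eq refl refl with cur-latest e s (λ z → 1+n≢0 (trans (sym eq) z))
... | latest t p i o q with attack-of (trans (cong tag i) eq) o
... | u , a = subst₂ (Attack e) u≡ t≡ a , subst (_< s) t≡ p , subst (λ w → Quiet e (suc w) s) t≡ q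
  where
  i′ = trans (sym (Attack.made a)) i
  u≡ : u ≡ tgt (cur e s)
  u≡ = trans (sym (tgt-entry _ _ _ _)) (cong tgt i′)
  t≡ : t ≡ new (cur e s)
  t≡ = trans (sym (new-entry _ _ _ _)) (cong new i′)

resolved-merge : ∀ {e t} → tag (history t) ≡ 2 → req (history t) ≡ e → ∃₂ λ u w → Resolved 2 e u w t ×
  eqv (log (suc t)) (side e) (φ e (log t) u) (φ e (log t) (start w)) ≡ false
resolved-merge {e} {t} eq refl with step-of (λ z → 1+n≢0 (trans (sym eq) z))
... | creating u _ _ _ h with () ← trans (sym eq) (trans (cong tag h) (tag-entry 1 _ u _))
... | escaping u w _ _ _ _ _ _ h with () ← trans (sym eq) (trans (cong tag h) (tag-entry 3 _ u w))
... | merging u w c cu cw h₁ h₂ q h with current-attack c cu cw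
... | a , w<t , qu = u , w , resolved h a w<t qu h₁ h₂ ,
  subst (λ L → eqv L (side e) (φ e (log t) u) (φ e (log t) (start w)) ≡ false) (sym (log-suc t)) q

resolved-escape : ∀ {e t} → tag (history t) ≡ 3 → req (history t) ≡ e → ∃₂ λ u w → Resolved 3 e u w t ×
  eqv (push (entry 2 e u w) (log t)) (side e) (φ e (log t) u) (φ e (log t) (start w)) ≡ true
resolved-escape {e} {t} eq refl with step-of (λ z → 1+n≢0 (trans (sym eq) z))
... | creating u _ _ _ h with () ← trans (sym eq) (trans (cong tag h) (tag-entry 1 _ u _))
... | merging u w _ _ _ _ _ _ h with () ← trans (sym eq) (trans (cong tag h) (tag-entry 2 _ u w))
... | escaping u w c cu cw h₁ h₂ q h with current-attack c cu cw
... | a , w<t , qu = u , w , resolved h a w<t qu h₁ h₂ , q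

attack-unique : ∀ {e e′ u u′ w} → Attack e u w → Attack e′ u′ w → e ≡ e′ × u ≡ u′
attack-unique a a′ = trans (sym (req-entry _ _ _ _)) (trans (cong req eq) (req-entry _ _ _ _)) ,
                     trans (sym (tgt-entry _ _ _ _)) (trans (cong tgt eq) (tgt-entry _ _ _ _))
  where eq = trans (sym (Attack.made a)) (Attack.made a′)

module _ {τ e u w t} (r : Resolved (suc τ) e u w t) where
  open Resolved r
  resolved-tag : tag (history t) ≡ suc τ
  resolved-tag = trans (cong tag made) (tag-entry _ _ _ _)

  resolved-req : req (history t) ≡ e
  resolved-req = trans (cong req made) (req-entry _ _ _ _)

  resolved-new : new (history t) ≡ w
  resolved-new = trans (cong new made) (new-entry _ _ _ _)

  resolved-acts : Acts e t
  resolved-acts = (λ z → 1+n≢0 (trans (sym resolved-tag) z)) , ≤-reflexive resolved-req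

-- Both resolutions belong to the requirement that created `w`, and the earlier one would break the
-- quiet interval of the later one. In particular no chain both merges and escapes.
resolved-unique : ∀ {τ τ′ e e′ u u′ w t t′} → Resolved (suc τ) e u w t → Resolved (suc τ′) e′ u′ w t′ → t ≡ t′
resolved-unique {t = t} {t′} r r′ with attack-unique (Resolved.attack r) (Resolved.attack r′)
... | refl , _ with <-cmp t t′
... | tri≈ _ eq _ = eq
... | tri< lt _ _ = ⊥-elim (<⇒≱ (Resolved.quiet r′ t (Resolved.after r) lt (proj₁ (resolved-acts r))) (proj₂ (resolved-acts r)))
... | tri> _ _ gt = ⊥-elim (<⇒≱ (Resolved.quiet r t′ (Resolved.after r′) gt (proj₁ (resolved-acts r′))) (proj₂ (resolved-acts r′)))

attack-acts : ∀ {e u w} → Attack e u w → Acts e w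
attack-acts a = (λ z → 1+n≢0 (trans (sym (trans (cong tag (Attack.made a)) (tag-entry _ _ _ _))) z)) ,
  ≤-reflexive (trans (cong req (Attack.made a)) (req-entry _ _ _ _))

-- An action of e resets all weaker requirements, whose later merges therefore only concern newer chains.
merge-late : ∀ {e e′ u w t s} → Acts e t → Quiet e (suc t) (suc s) → t < s → Resolved 2 e′ u w s → t < w
merge-late {e} {e′} {u} {w} {t} {s} (ne , le) q t<s r with <-cmp t w
... | tri< lt _ _ = lt
... | tri≈ _ refl _ = ⊥-elim (<⇒≱ e<e′ (subst (_≤ e) own le))
  where
  own : req (history t) ≡ e′
  own = trans (cong req (Attack.made (Resolved.attack r))) (req-entry _ _ _ _)
  e<e′ : e < e′
  e<e′ = subst (e <_) (resolved-req r) (q s t<s ≤-refl (proj₁ (resolved-acts r)))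
... | tri> _ _ gt = ⊥-elim (<⇒≱ (<-trans e<e′ (Resolved.quiet r t gt t<s ne)) le)
  where
  e<e′ : e < e′
  e<e′ = subst (e <_) (resolved-req r) (q s t<s ≤-refl (proj₁ (resolved-acts r)))

merged-time : ∀ {s x} → merged (log s) x ≡ true → ∃ λ t → t < s × ∃₂ λ e u → Resolved 2 e u (ch x) t
merged-time {s} m with happened-elim (proj₂ (merged-elim m))
... | t , t< , a , b with subst (t <_) (len-log s) t<
... | t<s with resolved-merge (trans (cong tag (sym (ent-log t<s))) a) refl
... | u , w , r , _ = t , t<s , _ , u , subst (λ w → Resolved 2 _ u w t) (trans (sym (resolved-new r)) (trans (cong new (sym (ent-log t<s))) b)) r

merged-at : ∀ {e u w t s} → Resolved 2 e u w t → t < s → ∀ {x} → ch x ≡ w → merged (log s) x ≡ true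
attack-ent : ∀ {e u w s} → Attack e u w → w < s → ent (log s) w ≡ entry 1 e u w
attack-ent a w<s = trans (ent-log w<s) (Attack.made a)

attack-created : ∀ {e u w s} → Attack e u w → w < s → created (log s) w ≡ true
attack-created a w<s = created-intro (trans (cong tag (attack-ent a w<s)) (tag-entry _ _ _ _))
  (subst (_< _) (sym (trans (cong tgt (attack-ent a w<s)) (tgt-entry _ _ _ _))) (Attack.below a))

merged-at {w = w} {t} {s} r t<s refl = merged-intro
  (attack-created (Resolved.attack r) (<-trans (Resolved.after r) t<s))
  (happened-intro (subst (t <_) (sym (len-log s)) t<s) (trans (cong tag (ent-log t<s)) (resolved-tag r))
    (trans (cong new (ent-log t<s)) (resolved-new r)))

-- By `merge-late`, merges after stage `t` concern chains newer than `t`, and the walk from `x`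
-- never meets these.
nf-quiet : ∀ {e t s} → Acts e t → t < s → Quiet e (suc t) s → ∀ {x} → ch x ≤ t → nf (log s) x ≡ nf (log (suc t)) x
nf-quiet {e} {t} {s} a t<s q {x} c≤t = nf-stable (log-⊑ t<s) back
  where
  back : ∀ y → ch y ≤ ch x → merged (log s) y ≡ true → merged (log (suc t)) y ≡ true
  back y y≤x m with merged-time m
  ... | t′ , t′<s , e′ , u , r with ≤-<-connex t′ t
  ... | inj₁ t′≤t = merged-at r (s≤s t′≤t) refl
  ... | inj₂ t<t′ = ⊥-elim (<⇒≱ (merge-late a (λ i p p′ → q i p (≤-trans p′ t′<s)) t<t′ r) (≤-trans y≤x c≤t))

-- Colours along the chains

attack-down : ∀ {e u w s x} → Attack e u w → w < s → ch x ≡ w → down (log s) x ≡ u ⊕ ps x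
attack-down {e} {u} {w} {s} {x} a w<s refl = element-ext
  (trans (ch-down _ x) (trans (cong ch eq) (sym (ch-⊕ u (ps x)))))
  (trans (ps-down _ x) (trans (cong (λ u → ps u + ps x) eq) (sym (ps-⊕ u (ps x)))))
  where
  eq : tgt (ent (log s) (ch x)) ≡ u
  eq = trans (cong tgt (attack-ent a w<s)) (tgt-entry _ _ _ _)

-- The last hypothesis says that an escape comes too late for `x`. The element copied has a smaller
-- measure than `x`, so its colour is final by the stage at which that of `x` is read.
col-copy : ∀ {e u w x} → Attack e u w → ch x ≡ w → (∀ {e′ u′ t} → Resolved 3 e′ u′ w t → ch x + ps x < t) →
           col x ≡ col (u ⊕ ps x)
col-copy {e} {u} {w} {x} a refl esc = trans (colour-go L c) (trans
  (colour-log (down L x) (<-trans (down-measure cr) ≤-refl)) (cong col (attack-down a w< refl)))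
  where
  L = log (stage x)
  w< : ch x < stage x
  w< = s≤s (m≤m+n _ _)
  cr : created L (ch x) ≡ true
  cr = attack-created a w<
  unescaped : ¬ (happened L 3 (ch x) (stage x) ≡ true)
  unescaped h with happened-elim h
  ... | t , t< , p , q with resolved-escape (trans (cong tag (sym (ent-log t<))) p) refl
  ... | u′ , w′ , r , _ with trans (sym (resolved-new r)) (trans (cong new (sym (ent-log t<))) q)
  ... | refl = <⇒≱ (esc r) (m<1+n⇒m≤n t<)
  c : copies L x ≡ true
  c = copies-intro cr (¬-not unescaped)

col-escaped : ∀ {e u w t x} → Resolved 3 e u w t → ch x ≡ w → t ≤ ch x + ps x → col x ≡ not (side e)
col-escaped {e} {u} {w} {t} {x} r refl t≤ = trans (colour-stop L (¬-not λ c →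
    true≢false (trans (sym h) (proj₂ (copies-elim c)))))
  (trans (colourAt-created (attack-created a w<)) (cong (not ∘ side) (trans (cong req (attack-ent a w<)) (req-entry _ _ _ _))))
  where
  L = log (stage x)
  a = Resolved.attack r
  w< : ch x < stage x
  w< = s≤s (m≤m+n _ _)
  h : happened L 3 (ch x) (stage x) ≡ true
  h = happened-intro (s≤s t≤) (trans (cong tag (ent-log (s≤s t≤))) (resolved-tag r))
        (trans (cong new (ent-log (s≤s t≤))) (resolved-new r))

col-down : ∀ {s x} → merged (log s) x ≡ true → col x ≡ col (down (log s) x)
col-down {s} {x} m with merged-time m
... | t , t<s , e , u , r = trans (col-copy (Resolved.attack r) refl absurd)
    (cong col (sym (attack-down (Resolved.attack r) (<-trans (Resolved.after r) t<s) refl)))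
  where
  absurd : ∀ {e′ u′ t′} → Resolved 3 e′ u′ (ch x) t′ → ch x + ps x < t′
  absurd r′ with resolved-unique r r′
  ... | refl with () ← trans (sym (resolved-tag r)) (resolved-tag r′)

-- A merged chain cannot escape, so its copying is permanent. Hence merging never identifies
-- elements of different colours.
col-nf : ∀ s x → col (nf (log s) x) ≡ col x
col-nf s = chain-induction _ go
  where
  go : ∀ x → (∀ y → ch y < ch x → col (nf (log s) y) ≡ col y) → col (nf (log s) x) ≡ col x
  go x ih with merged (log s) x in m
  ... | false = cong col (nf-stop _ m)
  ... | true  = trans (cong col (nf-go _ m)) (trans (ih _ (down-< (proj₁ (merged-elim m)))) (sym (col-down m)))

opaque
  unfolding attackable
  attackable-elim : ∀ {e L u} → attackable e L u ≡ true →
                    real L (side e) u ≡ true × halts e L u ≡ true × settled e L u (φ e L u) ≡ false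
  attackable-elim eq with ∧-elim eq
  ... | a , b with ∧-elim b
  ... | b , c = a , b , not-elim c

  attackable-intro : ∀ {e L u} → real L (side e) u ≡ true → halts e L u ≡ true →
                     settled e L u (φ e L u) ≡ false → attackable e L u ≡ true
  attackable-intro a b c = ∧-intro a (∧-intro b (cong not c))

opaque
  unfolding real
  real-elim : ∀ {s b x} → x < s → real (log s) b x ≡ true → col x ≡ b
  real-elim x<s eq = trans (sym (colour-log′ _ x<s)) (same-elim eq)

  real-intro : ∀ {s b x} → x < s → col x ≡ b → real (log s) b x ≡ true
  real-intro x<s eq = same-intro (trans (colour-log′ _ x<s) eq)

attack-col : ∀ {e u w} → Attack e u w → col u ≡ side e
attack-col a = real-elim (Attack.below a) (proj₁ (attackable-elim (Attack.cause a)))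

-- Any escape of `w` comes after stage `w`, and `w` is the measure of `start w`, so the first
-- element keeps the copied colour in every case.
attack-col-start : ∀ {e u w} → Attack e u w → col (start w) ≡ side e
attack-col-start {e} {u} {w} a = trans (col-copy a (ch-start w) early)
    (trans (cong col (trans (cong (u ⊕_) (ps-start w)) (⊕-0 u))) (attack-col a))
  where
  early : ∀ {e′ u′ t} → Resolved 3 e′ u′ w t → ch (start w) + ps (start w) < t
  early r rewrite ch-start w | ps-start w | +-identityʳ w = Resolved.after r

-- Finite injury

-- Tags 2 and 3 both end an attack, so they share the top digit; 0 is idle and 1 is waiting.
phase : ℕ → ℕ → ℕ
phase e s = tag (cur e s) ⊓ 2

-- An action raises one digit in base 3 and can only lower less significant ones.
progress : ℕ → ℕ → ℕ
progress zero    s = phase zero s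
progress (suc e) s = 3 * progress e s + phase (suc e) s

phase-acts : ∀ {e s} → tag (history s) ≢ 0 → req (history s) ≡ e → phase e s < phase e (suc s)
phase-acts {e} {s} ne refl = lemma (step-of ne)
  where
  now : cur e (suc s) ≡ history s
  now = trans (cur-suc e s) (update-own ne refl)
  lemma : Step e (log s) (history s) → phase e s < phase e (suc s)
  lemma (creating u c _ _ h) rewrite now | h | tag-entry 1 e u (len (log s)) | c = s≤s z≤n
  lemma (merging u w c _ _ _ _ _ h) rewrite now | h | tag-entry 2 e u w | c = s≤s (s≤s z≤n)
  lemma (escaping u w c _ _ _ _ _ h) rewrite now | h | tag-entry 3 e u w | c = s≤s (s≤s z≤n)

progress-idle : ∀ e {s} → ¬ Acts e s → progress e (suc s) ≡ progress e s
progress-idle zero    na = cong (λ x → tag x ⊓ 2) (cur-step zero _ na)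
progress-idle (suc e) na = cong₂ (λ p x → 3 * p + tag x ⊓ 2)
  (progress-idle e λ { (ne , le) → na (ne , ≤-trans le (n≤1+n e)) }) (cur-step (suc e) _ na)

progress-acts : ∀ e {s} → Acts e s → progress e s < progress e (suc s)
progress-acts zero (ne , z≤) = phase-acts ne (n≤0⇒n≡0 z≤)
progress-acts (suc e) {s} (ne , le) with m≤n⇒m<n∨m≡n le
... | inj₁ lt = ≤-trans (s≤s (+-mono-≤ ≤-refl (m⊓n≤n (tag (cur (suc e) s)) 2)))
    (≤-trans (≤-reflexive (trans (cong suc (+-comm (3 * progress e s) 2)) (sym (*-suc 3 (progress e s)))))
    (≤-trans (*-monoʳ-≤ 3 (progress-acts e (ne , m<1+n⇒m≤n lt))) (m≤m+n _ _)))
... | inj₂ eq = subst (λ p → 3 * progress e s + phase (suc e) s < 3 * p + phase (suc e) (suc s))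
    (sym (progress-idle e λ { (_ , le′) → <⇒≱ (≤-reflexive (sym eq)) le′ }))
    (+-monoʳ-< (3 * progress e s) (phase-acts ne eq))

progress-bound : ∀ e s → progress e s < 3 ^ suc e
progress-bound zero    s = s≤s (m⊓n≤n (tag (cur zero s)) 2)
progress-bound (suc e) s = ≤-trans (s≤s (+-mono-≤ ≤-refl (m⊓n≤n (tag (cur (suc e) s)) 2)))
  (≤-trans (≤-reflexive (trans (cong suc (+-comm (3 * progress e s) 2)) (sym (*-suc 3 (progress e s)))))
  (*-monoʳ-≤ 3 (progress-bound e s)))

progress-mono : ∀ e s → progress e s ≤ progress e (suc s)
progress-mono e s with tag (history s) ≟ 0 | req (history s) ≤? e
... | no ne  | yes le = <⇒≤ (progress-acts e (ne , le))
... | yes eq | _      = ≤-reflexive (sym (progress-idle e λ (ne , _) → ne eq))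
... | no _   | no gt  = ≤-reflexive (sym (progress-idle e λ (_ , le) → gt le))

progress-mono* : ∀ e {s t} → s ≤′ t → progress e s ≤ progress e t
progress-mono* e ≤′-refl     = ≤-refl
progress-mono* e (≤′-step p) = ≤-trans (progress-mono* e p) (progress-mono e _)

-- A constructive form: no last action of `e` is exhibited. Each failure to obtain `P` costs one
-- action, which raises `progress`, and after `3 ^ suc e` of them the bound is violated.
finite-injury : ∀ {P : Set} e → (∀ s → P ⊎ ∃ λ t → s ≤ t × Acts e t) → P
finite-injury {P} e step = finish (go (3 ^ suc e))
  where
  go : ∀ n → P ⊎ ∃ λ s → n ≤ progress e s
  go zero = inj₂ (0 , z≤n)
  go (suc n) with go n
  ... | inj₁ p = inj₁ p
  ... | inj₂ (s , le) with step s
  ... | inj₁ p = inj₁ p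
  ... | inj₂ (t , s≤t , a) = inj₂ (suc t , ≤-trans (s≤s (≤-trans le (progress-mono* e (≤⇒≤′ s≤t)))) (progress-acts e a))
  finish : P ⊎ (∃ λ s → 3 ^ suc e ≤ progress e s) → P
  finish (inj₁ p) = p
  finish (inj₂ (s , le)) = ⊥-elim (<⇒≱ (progress-bound e s) le)

-- The two equivalence relations

data Related (b : Bool) (s x y : ℕ) : Set where
  joined : col x ≡ b → col y ≡ b → nf (log s) x ≡ nf (log s) y → Related b s x y
  junk   : col x ≢ b → col y ≢ b → Related b s x y

_∼[_]_ : ℕ → Bool → ℕ → Set
x ∼[ b ] y = ∃ λ s → Related b s x y

nf-mono : ∀ {s t x y} → s ≤ t → nf (log s) x ≡ nf (log s) y → nf (log t) x ≡ nf (log t) y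
nf-mono s≤t eq = trans (nf-extend (log-⊑ s≤t) _) (trans (cong (nf _) eq) (sym (nf-extend (log-⊑ s≤t) _)))

related-mono : ∀ {b s t x y} → s ≤ t → Related b s x y → Related b t x y
related-mono s≤t (joined p q eq) = joined p q (nf-mono s≤t eq)
related-mono s≤t (junk p q)      = junk p q

∼-refl : ∀ {b x} → x ∼[ b ] x
∼-refl {b} {x} with col x ≟ᵇ b
... | yes p = 0 , joined p p refl
... | no p  = 0 , junk p p

∼-sym : ∀ {b x y} → x ∼[ b ] y → y ∼[ b ] x
∼-sym (s , joined p q eq) = s , joined q p (sym eq)
∼-sym (s , junk p q)      = s , junk q p

∼-trans : ∀ {b x y z} → x ∼[ b ] y → y ∼[ b ] z → x ∼[ b ] z
∼-trans (s , r) (s′ , r′) with related-mono (m≤m⊔n s s′) r | related-mono (m≤n⊔m s s′) r′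
... | joined p q eq | joined q′ r eq′ = s ⊔ s′ , joined p r (trans eq eq′)
... | junk p q      | junk q′ r       = s ⊔ s′ , junk p r
... | joined p q _  | junk q′ _       = ⊥-elim (q′ q)
... | junk p q      | joined q′ _ _   = ⊥-elim (q q′)

∼-col : ∀ {b x y} → x ∼[ b ] y → col x ≡ b → col y ≡ b
∼-col (_ , joined _ q _) _ = q
∼-col (_ , junk p _)     r = ⊥-elim (p r)

opaque
  unfolding eqv forward settled
  eqv-elim : ∀ {s b x y} → x < s → y < s → eqv (log s) b x y ≡ true → Related b s x y
  eqv-elim {s} {b} {x} {y} x< y< eq with real (log s) b x in rx
  ... | false = junk (λ c → true≢false (trans (sym (real-intro x< c)) rx))
                     (λ c → true≢false (trans (sym (real-intro y< c)) (not-elim eq)))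
  ... | true with ∧-elim eq
  ... | ry , n = joined (real-elim x< rx) (real-elim y< ry) (≡ᵇ-elim n)

  eqv-intro : ∀ {s b x y} → x < s → y < s → Related b s x y → eqv (log s) b x y ≡ true
  eqv-intro x< y< (joined p q n) rewrite real-intro x< p = ∧-intro (real-intro y< q) (≡ᵇ-intro n)
  eqv-intro {s} {b} {x} x< y< (junk p q) with real (log s) b x in rx
  ... | true  = ⊥-elim (p (real-elim x< rx))
  ... | false = cong not (¬-not (q ∘ real-elim y<))

  forward-elim : ∀ {L u v} → forward L u v ≡ true → ∃ λ p → nf L v ≡ nf L u ⊕ p
  forward-elim {L} {u} {v} eq with ∧-elim eq
  ... | c , l = ps (nf L v) ∸ ps (nf L u) , element-ext (trans (sym (≡ᵇ-elim c)) (sym (ch-⊕ _ _)))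
      (trans (sym (m+[n∸m]≡n le)) (sym (ps-⊕ _ _)))
    where
    le : ps (nf L u) ≤ ps (nf L v)
    le = ≮⇒≥ λ lt → true≢false (trans (sym (<ᵇ-intro lt)) (not-elim l))

  forward-intro : ∀ {L u v} p → nf L v ≡ nf L u ⊕ p → forward L u v ≡ true
  forward-intro {L} {u} {v} p eq rewrite eq | ch-⊕ (nf L u) p | ps-⊕ (nf L u) p =
    ∧-intro (≡ᵇ-intro {ch (nf L u)} refl) (cong not (<ᵇ-false (m≤m+n (ps (nf L u)) p)))

  settled-eqv : ∀ {e L u v} → kind e ≡ true → settled e L u v ≡ eqv L (side e) u v
  settled-eqv k rewrite k = refl

  settled-forward : ∀ {e L u v} → kind e ≡ false → settled e L u v ≡ real L (side e) v ∧ forward L u v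
  settled-forward k rewrite k = refl

-- Reductions are rigid

opaque
  unfolding program
  requirement : Bool → Bool → ℕ → ℕ
  requirement b k c = ⟨ ⟨ bit (not b) , bit (not k) ⟩ , c ⟩

  side-requirement : ∀ b k c → side (requirement b k c) ≡ b
  side-requirement b k c rewrite fst-pair ⟨ bit (not b) , bit (not k) ⟩ c | fst-pair (bit (not b)) (bit (not k)) = lemma b
    where
    lemma : ∀ b → (bit (not b) ≡ᵇ 0) ≡ b
    lemma true  = refl
    lemma false = refl

  kind-requirement : ∀ b k c → kind (requirement b k c) ≡ k
  kind-requirement b k c rewrite fst-pair ⟨ bit (not b) , bit (not k) ⟩ c | snd-pair (bit (not b)) (bit (not k)) = lemma k
    where
    lemma : ∀ b → (bit (not b) ≡ᵇ 0) ≡ b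
    lemma true  = refl
    lemma false = refl

  program-requirement : ∀ b k c → program (requirement b k c) ≡ c
  program-requirement b k c = snd-pair _ _

-- The entry of stage `w` creates a chain and merges nothing, and `e` is quiet afterwards. So what
-- is found at stage `t` can be held against the cause of the attack at stage `w`.
nf-attack : ∀ {e u w t x} → Attack e u w → w < t → Quiet e (suc w) t → ch x ≤ w → nf (log t) x ≡ nf (log w) x
nf-attack {e} {u} {w} {t} {x} a w<t q c≤ = trans (nf-quiet (attack-acts a) w<t q c≤)
    (nf-stable (log-⊑ (n≤1+n w)) back)
  where
  back : ∀ y → ch y ≤ ch x → merged (log (suc w)) y ≡ true → merged (log w) y ≡ true
  back y _ m with merged-time m
  ... | t′ , t′< , e′ , u′ , r with m≤n⇒m<n∨m≡n (m<1+n⇒m≤n t′<)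
  ... | inj₁ t′<w = merged-at r t′<w refl
  ... | inj₂ refl with () ← trans (sym (resolved-tag r)) (trans (cong tag (Attack.made a)) (tag-entry _ _ _ _))

escaped-unmerged : ∀ {e u w t s x} → Resolved 3 e u w t → ch x ≡ w → merged (log s) x ≡ false
escaped-unmerged {s = s} {x} r refl = ¬-not unmerged
  where
  unmerged : ¬ merged (log s) x ≡ true
  unmerged m with merged-time m
  ... | _ , _ , _ , _ , r′ with resolved-unique r r′
  ... | refl with () ← trans (sym (resolved-tag r)) (resolved-tag r′)

opaque
  unfolding eqv real
  eqv-cases : ∀ {L b x y} → eqv L b x y ≡ true →
              (colour L x ≡ b × colour L y ≡ b × nf L x ≡ nf L y) ⊎ (colour L x ≢ b × colour L y ≢ b)
  eqv-cases {L} {b} {x} {y} eq with real L b x in rx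
  ... | false = inj₂ ((λ c → true≢false (trans (sym (same-intro c)) rx)) ,
                      (λ c → true≢false (trans (sym (same-intro c)) (not-elim eq))))
  ... | true with ∧-elim eq
  ... | ry , n = inj₁ (same-elim rx , same-elim ry , ≡ᵇ-elim n)

-- Here `L⁺` is the log of the trial merge. It need not be of the form `log s`, since the chain may
-- escape instead, so its normal forms are derived from those of `L`: only normal forms on chain `w`
-- move.
module _ {e u w t} (a : Attack e u w) (w<t : w < t) where
  private
    L  = log t
    L⁺ = push (entry 2 e u w) L
    ext : L ⊑ L⁺
    ext = ⊑-push _ _

    len⁺ : len L⁺ ≡ suc (len L)
    len⁺ = len-push _ _

    back : ∀ y → ch y ≢ w → merged L⁺ y ≡ true → merged L y ≡ true
    back y ne m with merged-elim m
    ... | cr , h with happened-elim h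
    ... | i , i< , p , q with m≤n⇒m<n∨m≡n (m<1+n⇒m≤n (subst (i <_) len⁺ i<))
    ... | inj₂ refl = ⊥-elim (ne (trans (sym q) (trans (cong new (ent-push-new _ _)) (new-entry _ _ _ _))))
    ... | inj₁ i<L with subst (i <_) (len-log t) i<L
    ... | i<t with resolved-merge (trans (cong tag (sym (trans (ent-push-old _ _ i<L) (ent-log i<t)))) p) refl
    ... | _ , w′ , r , _ = merged-at r i<t
            (trans (sym q) (trans (cong new (trans (ent-push-old _ _ i<L) (ent-log i<t))) (resolved-new r)))

    merged⁺ : ∀ {z} → ch z ≡ w → merged L⁺ z ≡ true
    merged⁺ refl = merged-intro (created-mono ext (attack-created a w<t))
      (happened-intro (subst (len L <_) (sym len⁺) ≤-refl) (trans (cong tag (ent-push-new _ _)) (tag-entry _ _ _ _))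
        (trans (cong new (ent-push-new _ _)) (new-entry _ _ _ _)))

  nf-pushed-old : ∀ {x} → ch x < w → nf L⁺ x ≡ nf L x
  nf-pushed-old {x} x<w = nf-stable ext λ y y≤x → back y (<⇒≢ (≤-<-trans y≤x x<w))

  nf-pushed-other : ∀ {x} → ch (nf L x) ≢ w → nf L⁺ x ≡ nf L x
  nf-pushed-other {x} ne = trans (nf-extend ext x)
    (nf-stop L⁺ (¬-not λ m → true≢false (trans (sym (back _ ne m)) (nf-normal L x))))

  nf-pushed-copy : ∀ {x} → ch (nf L x) ≡ w → nf L⁺ x ≡ nf L u ⊕ ps (nf L x)
  nf-pushed-copy {x} eq = trans (nf-extend ext x) (trans (nf-go L⁺ (merged⁺ eq))
    (trans (cong (nf L⁺) (trans (down-cong (ent-≡ ext (subst (_< len L) (sym eq) (created-< {L = L} (attack-created a w<t)))))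
      (attack-down a w<t eq)))
    (trans (nf-pushed-old (subst (_< w) (sym (ch-⊕ u _)) (≤-<-trans (ch≤ u) (Attack.below a)))) (nf-⊕ L u _))))

module Rigidity (b : Bool) (f : ℕ → ℕ) (c : ℕ) (runs : ∀ x → ∃ λ s → output c x s ≡ suc (f x))
  (to : ∀ {x y} → x ∼[ b ] y → f x ∼[ b ] f y) (from : ∀ {x y} → f x ∼[ b ] f y → x ∼[ b ] y) where

  module Strategy (e : ℕ) (side-e : side e ≡ b) (program-e : program e ≡ c) where
    opaque
      unfolding halts
      halts-elim : ∀ {s x} → halts e (log s) x ≡ true → φ e (log s) x ≡ f x × f x < s
      halts-elim {s} {x} h rewrite program-e | len-log s = convergent-value c x (proj₂ (runs x)) h

      halts-eventually : ∀ x → ∃ λ s₀ → ∀ {s} → s₀ ≤ s → halts e (log s) x ≡ true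
      halts-eventually x with runs x
      ... | s₁ , o = s₁ ⊔ suc (f x) , λ {s} le → lemma s le
        where
        lemma : ∀ s → s₁ ⊔ suc (f x) ≤ s → halts e (log s) x ≡ true
        lemma s le rewrite program-e | len-log s =
          output-convergent c x o (≤-trans (m≤m⊔n _ _) le) (≤-trans (m≤n⊔m s₁ _) le)

    module _ {u w} (a : Attack e u w) where
      col-target : col u ≡ b
      col-target = trans (attack-col a) side-e

      col-copied : col (start w) ≡ b
      col-copied = trans (attack-col-start a) side-e

      private
        cause = attackable-elim (Attack.cause a)

      value-< : f u < w
      value-< = proj₂ (halts-elim (proj₁ (proj₂ cause)))

      unsettled : settled e (log w) u (f u) ≡ false
      unsettled = subst (λ v → settled e (log w) u v ≡ false) (proj₁ (halts-elim (proj₁ (proj₂ cause)))) (proj₂ (proj₂ cause))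

    module _ {u w t} (r : Resolved 2 e u w t) where
      open Resolved r
      merged-related : Related b (suc t) u (start w)
      merged-related = joined (col-target attack) (col-copied attack)
        (sym (trans (nf-go _ (merged-at r ≤-refl (ch-start w)))
          (cong (nf _) (trans (attack-down attack (≤-trans after (n≤1+n t)) (ch-start w))
            (trans (cong (u ⊕_) (ps-start w)) (⊕-0 u))))))

      -- Both images are below `t`, hence on chains that weaker requirements can no longer merge.
      -- Their being apart at stage `suc t` lasts until `e` or a stronger requirement acts.
      merge-succeeds : ∀ {s} → eqv (log (suc t)) (side e) (φ e (log t) u) (φ e (log t) (start w)) ≡ false →
        t < s → Quiet e (suc t) s → ¬ Related b s (f u) (f (start w))
      merge-succeeds {s} unequal t<s q rel with halts-elim halts₁ | halts-elim halts₂
      ... | φ₁ , <₁ | φ₂ , <₂ = true≢false (trans (sym (eqv-intro (≤-trans <₁ (n≤1+n t)) (≤-trans <₂ (n≤1+n t)) (back rel)))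
          (subst₂ (λ x y → eqv (log (suc t)) b x y ≡ false) φ₁ φ₂
            (subst (λ b → eqv (log (suc t)) b (φ e (log t) u) (φ e (log t) (start w)) ≡ false) side-e unequal)))
        where
        stable : ∀ {x} → x < t → nf (log s) x ≡ nf (log (suc t)) x
        stable x<t = nf-quiet (resolved-acts r) t<s q (≤-trans (ch≤ _) (<⇒≤ x<t))
        back : Related b s (f u) (f (start w)) → Related b (suc t) (f u) (f (start w))
        back (joined p q eq) = joined p q (trans (sym (stable <₁)) (trans eq (stable <₂)))
        back (junk p q)      = junk p q

    module _ {u w t} (r : Resolved 3 e u w t) where
      open Resolved r
      -- The chain `w` is never merged, so `start w` is its own normal form at all stages, while
      -- that of `u` lies on a chain below `w`.
      escaped-unrelated : ¬ u ∼[ b ] start w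
      escaped-unrelated (_ , junk p _) = p (col-target attack)
      escaped-unrelated (s , joined _ _ eq) = <⇒≱ (≤-<-trans (ch≤ u) (Attack.below attack))
        (≤-trans (≤-reflexive (sym (trans (cong ch (trans eq (nf-stop _ (escaped-unmerged r (ch-start w))))) (ch-start w))))
          (ch-nf≤ (log s) u))

      -- As `u` and `start w` are inequivalent, so are their images; both images being junk is
      -- thereby excluded, and the trial merge alone joins them. Now `f u` is below `w` and does not
      -- move under it, so the normal form of `f (start w)` does: it lies on chain `w`, at position
      -- `p`, and is carried to `nf u` shifted by `p`. The equation for `f u` is stated at stage `w`
      -- so that it can refute the cause of the attack.
      escape-shift : eqv (push (entry 2 e u w) (log t)) (side e) (φ e (log t) u) (φ e (log t) (start w)) ≡ true →
        ∃ λ p → nf (log w) (f u) ≡ nf (log w) u ⊕ p × nf (log t) (f (start w)) ≡ start w ⊕ p ×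
                col (f u) ≡ b × col (f (start w)) ≡ b
      escape-shift yes′ with halts-elim halts₁ | halts-elim halts₂
      ... | φ₁ , <₁ | φ₂ , <₂ = cases (eqv-cases (subst₂ (λ x y → eqv L⁺ b x y ≡ true) φ₁ φ₂
            (subst (λ b → eqv L⁺ b (φ e (log t) u) (φ e (log t) (start w)) ≡ true) side-e yes′)))
        where
        L⁺ = push (entry 2 e u w) (log t)
        colour⁺ : ∀ {x} → x < t → colour L⁺ x ≡ col x
        colour⁺ {x} x<t = trans (colour-back (⊑-push _ _) (subst (ch x + ps x <_) (sym (len-log t)) (≤-<-trans (ch+ps≤ x) x<t)))
                                (colour-log′ x x<t)
        z = nf (log t) (f (start w))
        fu<w = value-< attack
        cases : (colour L⁺ (f u) ≡ b × colour L⁺ (f (start w)) ≡ b × nf L⁺ (f u) ≡ nf L⁺ (f (start w)))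
                ⊎ (colour L⁺ (f u) ≢ b × colour L⁺ (f (start w)) ≢ b) →
                ∃ λ p → nf (log w) (f u) ≡ nf (log w) u ⊕ p × z ≡ start w ⊕ p × col (f u) ≡ b × col (f (start w)) ≡ b
        cases (inj₂ (p , q)) = ⊥-elim (escaped-unrelated
          (from (0 , junk (p ∘ trans (colour⁺ <₁)) (q ∘ trans (colour⁺ <₂)))))
        cases (inj₁ (p , q , eq)) with trans (sym (colour⁺ <₁)) p | trans (sym (colour⁺ <₂)) q
          | trans (sym (nf-pushed-old attack after (≤-<-trans (ch≤ _) fu<w))) eq | ch z ≟ w
        ... | p′ | q′ | eq′ | no ne = ⊥-elim (escaped-unrelated
                (from (t , joined p′ q′ (trans eq′ (nf-pushed-other attack after ne)))))
        ... | p′ | q′ | eq′ | yes eqw = ps z ,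
              trans (sym (nf-attack attack after quiet (≤-trans (ch≤ _) (<⇒≤ fu<w))))
                (trans (trans eq′ (nf-pushed-copy attack after eqw))
                  (cong (_⊕ ps z) (nf-attack attack after quiet (≤-trans (ch≤ u) (<⇒≤ (Attack.below attack)))))) ,
              trans (sym (start-⊕ z)) (cong (λ j → start j ⊕ ps z) eqw) , p′ , q′

    -- While `u` is unsettled, no state of `e` is final: idle, it can attack; waiting, it resolves
    -- once both computations halt; a lasting merge would contradict `to`; escapes are excluded by
    -- hypothesis. So actions of `e` or stronger requirements would recur, against finite injury.
    settles : (∀ {u w t} → Resolved 3 e u w t →
                 eqv (push (entry 2 e u w) (log t)) (side e) (φ e (log t) u) (φ e (log t) (start w)) ≡ true → ⊥) →
              ∀ {u} → col u ≡ b → ∃ λ s → u < s × f u < s × settled e (log s) u (f u) ≡ true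
    settles no-escape {u} cu = finite-injury e attend
      where
      Goal = ∃ λ s → u < s × f u < s × settled e (log s) u (f u) ≡ true
      Later : ℕ → Set
      Later s = ∃ λ t → s ≤ t × Acts e t

      later : ∀ {s s′} → s ≤ s′ → Later s′ → Later s
      later le (t , le′ , a) = t , ≤-trans le le′ , a

      quiet-later : ∀ {s} s′ → (Quiet e s s′ → Later s) → Later s
      quiet-later {s} s′ k with quiet? e s s′
      ... | inj₁ q = k q
      ... | inj₂ (t , s≤t , _ , a) = t , s≤t , a

      case₀ : ∀ {s} → u < s → e < s → halts e (log s) u ≡ true → tag (cur e s) ≡ 0 → Goal ⊎ Later s
      case₀ {s} u<s e<s h c₀ with settled e (log s) u (f u) in st
      ... | true  = inj₁ (s , u<s , proj₂ (halts-elim h) , st)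
      ... | false = inj₂ (s , ≤-refl , wants-acts e<s (wants-create e (log s) c₀ (subst (u <_) (sym (len-log s)) u<s)
              (attackable-intro (real-intro u<s (trans cu (sym side-e))) h
                (subst (λ v → settled e (log s) u v ≡ false) (sym (proj₁ (halts-elim h))) st))))

      case₁ : ∀ {s} → e < s → tag (cur e s) ≡ 1 → Later s
      case₁ {s} e<s c₁ with halts-eventually (tgt (cur e s)) | halts-eventually (start (new (cur e s)))
      ... | s₁ , h₁ | s₂ , h₂ = quiet-later s′ λ q → acts (cur-quiet e s≤s′ q)
        where
        s′ = s ⊔ (s₁ ⊔ s₂)
        s≤s′ = m≤m⊔n s (s₁ ⊔ s₂)
        acts : cur e s′ ≡ cur e s → Later s
        acts eq = s′ , s≤s′ , wants-acts (≤-trans e<s s≤s′) (wants-resolve e (log s′) (trans (cong tag eq) c₁)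
          (subst (λ x → halts e (log s′) (tgt x) ≡ true) (sym eq)
            (h₁ (≤-trans (m≤m⊔n s₁ s₂) (m≤n⊔m s (s₁ ⊔ s₂)))))
          (subst (λ x → halts e (log s′) (start (new x)) ≡ true) (sym eq)
            (h₂ (≤-trans (m≤n⊔m s₁ s₂) (m≤n⊔m s (s₁ ⊔ s₂))))))

      case₂ : ∀ {s} → Latest e s → tag (cur e s) ≡ 2 → Later s
      case₂ {s} (latest t t<s i o q) c₂ with resolved-merge (trans (cong tag i) c₂) o
      ... | u′ , w , r , no′ with to (suc t , merged-related r)
      -- By `to`, the images of the merged pair are related from stage `s₁` on. If all were quiet
      -- until then, the merge would have kept them apart.
      ... | s₁ , rel = quiet-later (s ⊔ s₁) λ q′ → ⊥-elim
        (merge-succeeds r no′ (≤-trans t<s (m≤m⊔n s s₁)) (both q′) (related-mono (m≤n⊔m s s₁) rel))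
        where
        both : Quiet e s (s ⊔ s₁) → Quiet e (suc t) (s ⊔ s₁)
        both q′ i t<i i< with ≤-<-connex s i
        ... | inj₁ s≤i = q′ i s≤i i<
        ... | inj₂ i<s = q i t<i i<s

      case₃ : ∀ {s} → Latest e s → tag (cur e s) ≡ 3 → ⊥
      case₃ (latest t _ i o _) c₃ with resolved-escape (trans (cong tag i) c₃) o
      ... | _ , _ , r , yes′ = no-escape r yes′

      case₄ : ∀ {s n} → Latest e s → tag (cur e s) ≡ suc (suc (suc (suc n))) → ⊥
      case₄ (latest t _ i o _) c₄ with trans (cong tag i) c₄
      ... | eq with step-of {t} (λ z → 1+n≢0 (trans (sym eq) z))
      ... | creating _ _ _ _ h with () ← trans (sym eq) (trans (cong tag h) (tag-entry 1 _ _ _))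
      ... | merging _ _ _ _ _ _ _ _ h with () ← trans (sym eq) (trans (cong tag h) (tag-entry 2 _ _ _))
      ... | escaping _ _ _ _ _ _ _ _ h with () ← trans (sym eq) (trans (cong tag h) (tag-entry 3 _ _ _))

      split : ∀ {s} → u < s → e < s → halts e (log s) u ≡ true → Goal ⊎ Later s
      split {s} u<s e<s h with tag (cur e s) in c
      ... | 0 = case₀ u<s e<s h c
      ... | 1 = inj₂ (case₁ e<s c)
      ... | 2 = inj₂ (case₂ (cur-latest e s λ z → 1+n≢0 (trans (sym c) z)) c)
      ... | 3 = ⊥-elim (case₃ (cur-latest e s λ z → 1+n≢0 (trans (sym c) z)) c)
      ... | suc (suc (suc (suc _))) = ⊥-elim (case₄ (cur-latest e s λ z → 1+n≢0 (trans (sym c) z)) c)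

      attend : ∀ s → Goal ⊎ Later s
      attend s with halts-eventually u
      ... | s₁ , h₁ with split {s ⊔ (s₁ ⊔ (suc u ⊔ suc e))}
              (≤-trans (m≤m⊔n (suc u) (suc e)) (≤-trans (m≤n⊔m s₁ _) (m≤n⊔m s _)))
              (≤-trans (m≤n⊔m (suc u) (suc e)) (≤-trans (m≤n⊔m s₁ _) (m≤n⊔m s _)))
              (h₁ (≤-trans (m≤m⊔n s₁ _) (m≤n⊔m s _)))
      ... | inj₁ g = inj₁ g
      ... | inj₂ l = inj₂ (later (m≤m⊔n s _) l)

  module Forward where
    private
      e = requirement b false c
      kind-e = kind-requirement b false c
    open Strategy e (side-requirement b false c) (program-requirement b false c)

    -- An escape shows that `f u` was a shift of `u` already at the stage of the attack, but then an
    -- attack of this kind is not made. So escapes are impossible and `settles` applies.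
    forward-orbit : ∀ {u} → col u ≡ b → ∃ λ p → f u ∼[ b ] (u ⊕ p) × col (u ⊕ p) ≡ b
    forward-orbit {u} cu with settles no-escape cu
      where
      no-escape : ∀ {u w t} → Resolved 3 e u w t →
                 eqv (push (entry 2 e u w) (log t)) (side e) (φ e (log t) u) (φ e (log t) (start w)) ≡ true → ⊥
      no-escape r y with escape-shift r y
      ... | p , eq , _ , cf , _ = true≢false (trans (sym (∧-intro
              (real-intro (value-< (Resolved.attack r)) (trans cf (sym (side-requirement b false c)))) (forward-intro p eq)))
              (trans (sym (settled-forward kind-e)) (unsettled (Resolved.attack r))))
    ... | s , u<s , fu<s , st with ∧-elim (trans (sym (settled-forward kind-e)) st)
    ... | rl , fw with forward-elim {log s} fw
    ... | p , eq = p , (s , joined cf cp eq′) , cp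
      where
      cf : col (f u) ≡ b
      cf = trans (real-elim fu<s rl) (side-requirement b false c)
      eq′ : nf (log s) (f u) ≡ nf (log s) (u ⊕ p)
      eq′ = trans eq (sym (nf-⊕ _ u p))
      cp : col (u ⊕ p) ≡ b
      cp = trans (sym (col-nf s (u ⊕ p))) (trans (cong col (sym eq′)) (trans (col-nf s (f u)) cf))

  module Identity where
    open Forward
    private
      e = requirement b true c
      kind-e = kind-requirement b true c
      side-e = side-requirement b true c
    open Strategy e side-e (program-requirement b true c)

    module _ {u w t} (r : Resolved 3 e u w t) where
      private
        Arrow : ℕ → Set
        Arrow n = ∃₂ λ q q′ → q < q′ × n ≤ q′ × col (start w ⊕ q) ≡ b × col (start w ⊕ q′) ≡ b ×
                  f (start w ⊕ q) ∼[ b ] (start w ⊕ q′)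

        -- Normal forms commute with the shift, so distinct positions of one chain keep distinct
        -- normal forms.
        position-unique : ∀ {q q′} → col (start w ⊕ q) ≡ b → (start w ⊕ q) ∼[ b ] (start w ⊕ q′) → q ≡ q′
        position-unique cq (_ , junk p _) = ⊥-elim (p cq)
        position-unique {q} {q′} cq (s , joined _ _ eq) = +-cancelˡ-≡ (ps (nf (log s) (start w))) q q′
          (trans (sym (ps-⊕ _ q)) (trans (cong ps (trans (sym (nf-⊕ _ _ q)) (trans eq (nf-⊕ _ _ q′)))) (ps-⊕ _ q′)))

        advance : ∀ {n} → Arrow n → Arrow (suc n)
        advance {n} (q , q′ , q<q′ , n≤q′ , cq , cq′ , arrow) = next (forward-orbit cq′)
          where
          next : (∃ λ p → f (start w ⊕ q′) ∼[ b ] (start w ⊕ q′ ⊕ p) × col (start w ⊕ q′ ⊕ p) ≡ b) → Arrow (suc n)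
          -- If `f` did not move position `q′`, then `q` and `q′` would have equivalent images,
          -- against injectivity on classes.
          next (zero , rel , _) = ⊥-elim (<-irrefl q≡q′ q<q′)
            where
            back : f (start w ⊕ q′) ∼[ b ] (start w ⊕ q′)
            back = subst (f (start w ⊕ q′) ∼[ b ]_) (⊕-0 (start w ⊕ q′)) rel
            q≡q′ : q ≡ q′
            q≡q′ = position-unique cq (from {start w ⊕ q} {start w ⊕ q′} (∼-trans arrow (∼-sym back)))
          next (suc j , rel , cj) = q′ , q′ + suc j , q′< , ≤-trans (s≤s n≤q′) q′< , cq′ ,
              subst (λ x → col x ≡ b) (⊕-⊕ (start w) q′ (suc j)) cj ,
              subst (f (start w ⊕ q′) ∼[ b ]_) (⊕-⊕ (start w) q′ (suc j)) rel
            where q′< = m<m+n q′ {suc j} (s≤s z≤n)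

      -- f moves start w strictly forward along its chain, hence, being injective, iterates of f
      -- leave the finite part of the chain that was coloured b before the escape.
      escape-impossible : eqv (push (entry 2 e u w) (log t)) (side e) (φ e (log t) u) (φ e (log t) (start w)) ≡ true → ⊥
      escape-impossible y with escape-shift r y
      -- With shift 0, `f u` would be equivalent to `u` at stage `w`, contrary to the cause of the
      -- attack.
      ... | zero , eq , _ , cf , _ = true≢false (trans
              (sym (eqv-intro (Attack.below (Resolved.attack r)) (value-< (Resolved.attack r))
                (joined (trans (col-target (Resolved.attack r)) (sym side-e)) (trans cf (sym side-e)) (sym (trans eq (⊕-0 _))))))
              (trans (sym (settled-eqv kind-e)) (unsettled (Resolved.attack r))))
      ... | suc p , _ , eq , _ , cf = finish (go t)
        where
        nf-start : nf (log t) (start w) ≡ start w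
        nf-start = nf-stop _ (escaped-unmerged r (ch-start w))
        eq′ : nf (log t) (f (start w)) ≡ nf (log t) (start w ⊕ suc p)
        eq′ = trans eq (sym (trans (nf-⊕ _ _ _) (cong (_⊕ suc p) nf-start)))
        cp : col (start w ⊕ suc p) ≡ b
        cp = trans (sym (col-nf t _)) (trans (cong col (sym eq′)) (trans (col-nf t _) cf))
        go : ∀ n → Arrow n
        go zero = 0 , suc p , s≤s z≤n , z≤n , trans (cong col (⊕-0 (start w))) (col-copied (Resolved.attack r)) , cp ,
          (t , joined (trans (cong (col ∘ f) (⊕-0 (start w))) cf) cp (trans (cong (nf (log t) ∘ f) (⊕-0 (start w))) eq′))
        go (suc n) = advance (go n)
        finish : Arrow t → ⊥
        finish (_ , q′ , _ , t≤q′ , _ , cq′ , _) = not-¬ refl (trans (trans (sym cq′) (col-escaped r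
            (trans (ch-⊕ _ q′) (ch-start w)) late)) (cong not side-e))
          where
          late : t ≤ ch (start w ⊕ q′) + ps (start w ⊕ q′)
          late rewrite ps-⊕ (start w) q′ | ps-start w = ≤-trans t≤q′ (m≤n+m q′ _)

    fixes-real : ∀ {u} → col u ≡ b → u ∼[ b ] f u
    fixes-real {u} cu with settles escape-impossible cu
    ... | s , u<s , fu<s , st = s , subst (λ b → Related b s u (f u)) side-e
          (eqv-elim u<s fu<s (trans (sym (settled-eqv kind-e)) st))

  fixes : ∀ u → f u ∼[ b ] u
  fixes u with col u ≟ᵇ b | col (f u) ≟ᵇ b
  ... | yes cu | _      = ∼-sym (Identity.fixes-real cu)
  ... | no nu  | no nf′ = 0 , junk nf′ nu
  -- Here `f u` is real, so `f` fixes its class; reflecting `f u ∼ f (f u)` along `f` gives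
  -- `u ∼ f u`, and then `u` would be real.
  ... | no nu  | yes cf = ⊥-elim (nu (∼-col (∼-sym (from (Identity.fixes-real cf))) cf))

-- Computable enumerability

mutual
  Eval-deterministic : ∀ {n} {c : PR n} {xs v w} → Eval c xs v → Eval c xs w → v ≡ w
  Eval-deterministic ev-zer  ev-zer  = refl
  Eval-deterministic ev-succ ev-succ = refl
  Eval-deterministic ev-proj ev-proj = refl
  Eval-deterministic (ev-comp a e) (ev-comp b d) with EvalAll-deterministic a b
  ... | refl = Eval-deterministic e d
  Eval-deterministic (ev-prec-z e) (ev-prec-z d) = Eval-deterministic e d
  Eval-deterministic (ev-prec-s r e) (ev-prec-s s d) with Eval-deterministic r s
  ... | refl = Eval-deterministic e d
  Eval-deterministic (ev-mu {y = y} e p) (ev-mu {y = z} d q) with <-cmp y z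
  ... | tri≈ _ eq _ = eq
  ... | tri< lt _ _ with q y lt
  ... | w , d′ with () ← Eval-deterministic e d′
  Eval-deterministic (ev-mu {y = y} e p) (ev-mu {y = z} d q) | tri> _ _ gt with p z gt
  ... | w , e′ with () ← Eval-deterministic e′ d

  EvalAll-deterministic : ∀ {m n} {gs : Vec (PR n) m} {xs ys zs} → EvalAll gs xs ys → EvalAll gs xs zs → ys ≡ zs
  EvalAll-deterministic ev-[] ev-[] = refl
  EvalAll-deterministic (ev-∷ e es) (ev-∷ d ds) = cong₂ _∷_ (Eval-deterministic e d) (EvalAll-deterministic es ds)

least : ∀ (p : ℕ → Bool) {n} → p n ≡ true → ∃ λ m → p m ≡ true × (∀ z → z < m → p z ≡ false)
least p {n} pn with search n
  where
  search : ∀ n → (∀ z → z < n → p z ≡ false) ⊎ ∃ λ m → p m ≡ true × (∀ z → z < m → p z ≡ false)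
  search zero = inj₁ λ _ ()
  search (suc n) with search n | p n in pn
  ... | inj₂ found | _    = inj₂ found
  ... | inj₁ none  | true = inj₂ (n , pn , none)
  ... | inj₁ none  | false = inj₁ λ z z<n → below z (m≤n⇒m<n∨m≡n (m<1+n⇒m≤n z<n))
    where
    below : ∀ z → z < n ⊎ z ≡ n → p z ≡ false
    below z (inj₁ lt)   = none z lt
    below z (inj₂ refl) = pn
... | inj₂ found = found
... | inj₁ none  = n , pn , none

enumerable : {R : ℕ → ℕ → Set} {A : Vec ℕ 3 → Bool} → PrimBool A →
             (∀ {x y} → R x y → ∃ λ s → A (s ∷ x ∷ y ∷ []) ≡ true) →
             (∀ {x y s} → A (s ∷ x ∷ y ∷ []) ≡ true → R x y) → CE R
enumerable {R} {A} a sound complete = mu c , λ x y → mk⇔ (there x y) (back x y)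
  where
  -- `mu` searches for a zero, hence the negation.
  c = code (asBit (notᵖ a))
  ev = eval (asBit (notᵖ a))

  there : ∀ x y → R x y → Σ ℕ λ v → Eval (mu c) (x ∷ y ∷ []) v
  there x y r with least (λ s → A (s ∷ x ∷ y ∷ [])) (proj₂ (sound r))
  ... | m , hit , before = m , ev-mu (subst (Eval c _) (cong (bit ∘ not) hit) (ev _))
    λ z z<m → 0 , subst (Eval c _) (cong (bit ∘ not) (before z z<m)) (ev _)

  back : ∀ x y → (Σ ℕ λ v → Eval (mu c) (x ∷ y ∷ []) v) → R x y
  back x y (v , ev-mu e _) = complete (lemma (A _) (Eval-deterministic (ev _) e))
    where
    lemma : ∀ b → bit (not b) ≡ 0 → b ≡ true
    lemma true _ = refl

computable : {f : ℕ → ℕ} → Prim {1} (λ ρ → f (lookup ρ zero)) → Computable f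
computable (prim code eval) = code , λ x → eval (x ∷ [])

∼-ceer : ∀ b → Ceer (λ x y → x ∼[ b ] y)
∼-ceer b = record { refl = ∼-refl ; sym = ∼-sym ; trans = ∼-trans } , enumerable decide sound (λ {x} {y} {s} → complete {x} {y} {s})
  where
  -- The stage exceeds both elements, so the colours read from the log are the final ones.
  bound : Vec ℕ 3 → ℕ
  bound ρ = suc (lookup ρ zero + (lookup ρ (suc zero) + lookup ρ (suc (suc zero))))

  decide : PrimBool (λ ρ → eqv (log (bound ρ)) b (lookup ρ (suc zero)) (lookup ρ (suc (suc zero))))
  decide = eqvᵖ (logᵖ (sucᵖ (varᵖ zero +ᵖ (varᵖ (suc zero) +ᵖ varᵖ (suc (suc zero)))))) (constᵇ b)
    (varᵖ (suc zero)) (varᵖ (suc (suc zero)))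

  x< : ∀ s x y → x < suc (s + (x + y))
  x< s x y = s≤s (≤-trans (m≤m+n x y) (m≤n+m (x + y) s))

  y< : ∀ s x y → y < suc (s + (x + y))
  y< s x y = s≤s (≤-trans (m≤n+m y x) (m≤n+m (x + y) s))

  sound : ∀ {x y} → x ∼[ b ] y → ∃ λ s → eqv (log (suc (s + (x + y)))) b x y ≡ true
  sound {x} {y} (s , r) = s , eqv-intro (x< s x y) (y< s x y) (related-mono (≤-trans (m≤m+n s (x + y)) (n≤1+n _)) r)

  complete : ∀ {x y s} → eqv (log (suc (s + (x + y)))) b x y ≡ true → x ∼[ b ] y
  complete {x} {y} {s} eq = _ , eqv-elim (x< s x y) (y< s x y) eq

∼-selfFull : ∀ b → SelfFull (λ x y → x ∼[ b ] y)
∼-selfFull b f (computes , red) x with universal computes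
... | c , runs = x , Rigidity.fixes b f c runs (Equivalence.to (red _ _)) (Equivalence.from (red _ _)) x

-- The uniform join

inject : Bool → ℕ → ℕ
inject true  x = 2 * x
inject false x = suc (2 * x)

even : ℕ → Bool
even zero    = true
even (suc n) = not (even n)

half : ℕ → ℕ
half zero    = 0
half (suc n) = if even n then half n else suc (half n)

evenᵖ : Prim F → PrimBool (even ∘ F)
evenᵖ {F = F} a = PrimBool-cong (λ ρ → trans (cong (0 <ᵇ_) (lemma (F ρ))) (positive (even (F ρ))))
  (zeroᵖ <ᵖ primrecᵖ {f = λ _ _ r → 1 ∸ r} (constᵖ 1) (constᵖ 1 ∸ᵖ weaken headᵖ) a)
  where
  complement : ∀ b → 1 ∸ bit b ≡ bit (not b)
  complement true  = refl
  complement false = refl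
  lemma : ∀ n → primrec 1 (λ _ r → 1 ∸ r) n ≡ bit (even n)
  lemma zero    = refl
  lemma (suc n) = trans (cong (1 ∸_) (lemma n)) (complement (even n))
  positive : ∀ b → (0 <ᵇ bit b) ≡ b
  positive true  = refl
  positive false = refl

halfᵖ : Prim F → Prim (half ∘ F)
halfᵖ {F = F} a = Prim-cong (lemma ∘ F)
  (primrecᵖ {f = λ _ n r → if even n then r else suc r} zeroᵖ
    (ifᵖ (evenᵖ headᵖ) (weaken headᵖ) (sucᵖ (weaken headᵖ))) a)
  where
  lemma : ∀ n → primrec 0 (λ n r → if even n then r else suc r) n ≡ half n
  lemma zero    = refl
  lemma (suc n) rewrite lemma n = refl

even-double : ∀ x → even (2 * x) ≡ true
even-double zero    = refl
even-double (suc x) rewrite +-suc x (x + 0) = trans (not-involutive _) (even-double x)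

half-double : ∀ x → half (2 * x) ≡ x
half-double zero    = refl
half-double (suc x) rewrite +-suc x (x + 0) | even-double x = cong suc (half-double x)

even-inject : ∀ b x → even (inject b x) ≡ b
even-inject true  x = even-double x
even-inject false x = cong not (even-double x)

half-inject : ∀ b x → half (inject b x) ≡ x
half-inject true  x = half-double x
half-inject false x rewrite even-double x = half-double x

inject-surjective : ∀ z → inject (even z) (half z) ≡ z
inject-surjective zero = refl
inject-surjective (suc z) with even z | inject-surjective z
... | true  | eq = cong suc eq
... | false | eq = trans (cong suc (+-suc (half z) (half z + 0))) (cong suc eq)

_≈_ : ℕ → ℕ → Set
_≈_ = Join (λ x y → x ∼[ true ] y) (λ x y → x ∼[ false ] y)

≈-intro : ∀ b {x y} → x ∼[ b ] y → inject b x ≈ inject b y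
≈-intro true  = left
≈-intro false = right

-- The indices `2 * x` and `suc (2 * x)` of `Join` do not give back `x` by unification; parity and
-- halving do.
≈-view : ∀ {z z′} → z ≈ z′ → even z ≡ even z′ × half z ∼[ even z ] half z′
≈-view (left {x} {y} r)
  rewrite even-double x | even-double y | half-double x | half-double y = refl , r
≈-view (right {x} {y} r)
  rewrite even-double x | even-double y | half-double x | half-double y = refl , r

≈-elim : ∀ b b′ x y → inject b x ≈ inject b′ y → b ≡ b′ × x ∼[ b ] y
≈-elim b b′ x y r with ≈-view r
... | p , q rewrite even-inject b x | even-inject b′ y | half-inject b x | half-inject b′ y = p , q

-- A real element moves one step along its chain, to the side of the colour found there.
advance : Bool → ℕ → ℕ
advance b x = if same (col x) b then inject (col (x ⊕ 1)) (x ⊕ 1) else inject b x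

joinMap : ℕ → ℕ
joinMap z = advance (even z) (half z)

advance-real : ∀ {b x} → col x ≡ b → advance b x ≡ inject (col (x ⊕ 1)) (x ⊕ 1)
advance-real {b} {x} c rewrite same-intro c = refl

advance-junk : ∀ {b x} → col x ≢ b → advance b x ≡ inject b x
advance-junk {b} {x} c rewrite ¬-not (c ∘ same-elim) = refl

joinMap-computable : Computable joinMap
joinMap-computable = computable (ifᵖ (same-colᵖ half-z (evenᵖ z)) (injectᵖ (colᵖ next) next) (injectᵖ (evenᵖ z) half-z))
  where
  z = varᵖ {1} zero
  half-z = halfᵖ z
  next = ⊕ᵖ half-z (constᵖ 1)

  colᵖ : Prim F → PrimBool (col ∘ F)
  colᵖ x = colourᵖ (logᵖ (sucᵖ (chᵖ x +ᵖ psᵖ x))) x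

  same-colᵖ : Prim F → PrimBool A → PrimBool (λ ρ → same (col (F ρ)) (A ρ))
  same-colᵖ x b = ifᵇ (colᵖ x) b (notᵖ b)

  injectᵖ : PrimBool A → Prim F → Prim (λ ρ → inject (A ρ) (F ρ))
  injectᵖ {A = A} {F} b x = Prim-cong (λ ρ → lemma (A ρ) (F ρ)) (ifᵖ b (x +ᵖ (x +ᵖ zeroᵖ)) (sucᵖ (x +ᵖ (x +ᵖ zeroᵖ))))
    where
    lemma : ∀ b x → (if b then 2 * x else suc (2 * x)) ≡ inject b x
    lemma true  x = refl
    lemma false x = refl

nf-injective-⊕ : ∀ {L x y} k → nf L (x ⊕ k) ≡ nf L (y ⊕ k) → nf L x ≡ nf L y
nf-injective-⊕ {L} {x} {y} k eq = element-ext
  (trans (sym (ch-⊕ _ k)) (trans (cong ch eq′) (ch-⊕ _ k)))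
  (+-cancelʳ-≡ k _ _ (trans (sym (ps-⊕ _ k)) (trans (cong ps eq′) (ps-⊕ _ k))))
  where
  eq′ : nf L x ⊕ k ≡ nf L y ⊕ k
  eq′ = trans (sym (nf-⊕ L x k)) (trans eq (nf-⊕ L y k))

nf-col : ∀ {s x y} → nf (log s) x ≡ nf (log s) y → col x ≡ col y
nf-col {s} eq = trans (sym (col-nf s _)) (trans (cong col eq) (col-nf s _))

-- Equal normal forms stay equal after a shift and force equal colours, so two equivalent real
-- elements are sent to the same side.
advance-to : ∀ {b x y} → x ∼[ b ] y → advance b x ≈ advance b y
advance-to {b} {x} {y} (s , joined p q eq) =
  subst₂ _≈_ (sym (advance-real p)) (trans (cong (λ c → inject c (y ⊕ 1)) same-col) (sym (advance-real q)))
    (≈-intro (col (x ⊕ 1)) (s , joined refl (sym same-col) eq⁺))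
  where
  eq⁺ : nf (log s) (x ⊕ 1) ≡ nf (log s) (y ⊕ 1)
  eq⁺ = trans (nf-⊕ _ x 1) (trans (cong (_⊕ 1) eq) (sym (nf-⊕ _ y 1)))
  same-col : col (x ⊕ 1) ≡ col (y ⊕ 1)
  same-col = nf-col eq⁺
advance-to {b} (s , junk p q) = subst₂ _≈_ (sym (advance-junk p)) (sym (advance-junk q)) (≈-intro b (s , junk p q))

-- Real elements go to elements real on the side they arrive at, and junk stays junk, so the mixed
-- cases cannot occur. Between real elements the shift cancels in normal forms, and equal normal
-- forms give equal colours, hence equal sides.
advance-from : ∀ {b b′ x y} → advance b x ≈ advance b′ y → b ≡ b′ × x ∼[ b ] y
advance-from {b} {b′} {x} {y} r with col x ≟ᵇ b | col y ≟ᵇ b′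
... | yes p | no q with ≈-elim (col (x ⊕ 1)) b′ (x ⊕ 1) y (subst₂ _≈_ (advance-real p) (advance-junk q) r)
... | eq , r′ = ⊥-elim (q (trans (∼-col r′ refl) eq))
advance-from {b} {b′} {x} {y} r | no p | yes q with ≈-elim b (col (y ⊕ 1)) x (y ⊕ 1) (subst₂ _≈_ (advance-junk p) (advance-real q) r)
... | eq , r′ = ⊥-elim (p (∼-col (∼-sym r′) (sym eq)))
advance-from {b} {b′} {x} {y} r | no p | no q = ≈-elim b b′ x y (subst₂ _≈_ (advance-junk p) (advance-junk q) r)
advance-from {x = x} {y} r | yes p | yes q with ≈-elim (col (x ⊕ 1)) (col (y ⊕ 1)) (x ⊕ 1) (y ⊕ 1) (subst₂ _≈_ (advance-real p) (advance-real q) r)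
... | _ , s , junk c _ = ⊥-elim (c refl)
... | _ , s , joined _ _ eq = trans (sym p) (trans same-col q) , s , joined p (trans (sym same-col) p) eq⁻
  where
  eq⁻ : nf (log s) x ≡ nf (log s) y
  eq⁻ = nf-injective-⊕ 1 eq
  same-col : col x ≡ col y
  same-col = nf-col eq⁻

joinMap-reduction : IsReduction _≈_ _≈_ joinMap
joinMap-reduction = joinMap-computable , λ z z′ → mk⇔ to (from z z′)
  where
  to : ∀ {z z′} → z ≈ z′ → joinMap z ≈ joinMap z′
  to {z} {z′} r with ≈-view r
  ... | eq , r′ = subst (λ b → joinMap z ≈ advance b (half z′)) eq (advance-to r′)

  from : ∀ z z′ → joinMap z ≈ joinMap z′ → z ≈ z′
  from z z′ r with advance-from {even z} {even z′} {half z} {half z′} r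
  ... | eq , r′ = subst₂ _≈_ (inject-surjective z)
    (trans (cong (λ b → inject b (half z′)) eq) (inject-surjective z′)) (≈-intro (even z) r′)

origin-unmerged : ∀ {L} → merged L (start 0) ≡ false
origin-unmerged {L} = ¬-not λ m → absurd (proj₂ (created-elim (subst (λ j → created L j ≡ true) (ch-start 0) (proj₁ (merged-elim m)))))
  where
  absurd : ∀ {n} → ¬ n < 0
  absurd ()

-- Chain 0 has no smaller target to copy and is never merged, so `start 0` is normal with position
-- 0. A shifted element has a normal form of positive position, and junk is not equivalent to the
-- real `start 0`.
joinMap-misses : ∀ z → ¬ joinMap z ≈ inject (col (start 0)) (start 0)
joinMap-misses z r with col (half z) ≟ᵇ even z
... | no p with ≈-elim (even z) (col (start 0)) (half z) (start 0) (subst (_≈ _) (advance-junk p) r)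
... | eq , r′ = p (∼-col (∼-sym r′) (sym eq))
joinMap-misses z r | yes p with ≈-elim (col (half z ⊕ 1)) (col (start 0)) (half z ⊕ 1) (start 0) (subst (_≈ _) (advance-real p) r)
... | _ , s , junk c _ = c refl
... | _ , s , joined _ _ eq = 1+n≢0 (trans (sym (trans (cong ps (nf-⊕ _ _ 1)) (trans (ps-⊕ _ 1) (+-comm _ 1))))
  (trans (cong ps (trans eq (nf-stop _ origin-unmerged))) (ps-start 0)))

mainTheorem1 : Σ (ℕ → ℕ → Set) λ X → Σ (ℕ → ℕ → Set) λ Y →
    Ceer X × Ceer Y × SelfFull X × SelfFull Y × ¬ SelfFull (Join X Y)
mainTheorem1 = _ , _ , ∼-ceer true , ∼-ceer false , ∼-selfFull true , ∼-selfFull false ,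
  λ full → let z , r = full joinMap joinMap-reduction (inject (col (start 0)) (start 0)) in joinMap-misses z r
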